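{- Let $r$ and $n$ be integers such that $2 \le r \le n$ and $n \equiv 0 \pmod r$. For $k \ge 2$, if $F_1, F_2, \ldots, F_k$ are graphs on a common set of $n$ vertices, each of which consists of the vertex-disjoint union of $n/r$ copies of $K_r$, then \[ \gamma_{\rm sd}(F_1,F_2,\ldots,F_k) \le \left( 1 - \left( \frac{r-1}{r} \right) \left( \frac{1}{k} \right)^{\frac{1}{r-1}} \right) n \le \frac{n(\ln(k) + 1)}{r}. \]
   Context: All graphs are finite and simple. Given graphs $F_1,\ldots,F_k$ (called factors; not necessarily edge-disjoint) with common vertex set $V$, a set $S \subseteq V$ is a simultaneous dominating set if for every $i$, $1 \le i \le k$, every vertex not in $S$ is adjacent in $F_i$ to some vertex of $S$. The simultaneous domination number $\gamma_{\rm sd}(F_1,\ldots,F_k)$ is the minimum cardinality of a simultaneous dominating set. -}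

module Defs where

open import Level using (0ℓ)
open import Data.Nat.Base as ℕ using (ℕ; zero; suc; NonZero; z≤n; s≤s)
import Data.Nat.Properties as ℕ
open import Data.Nat.Tactic.RingSolver using (solve-∀)
open import Data.Integer.Base as ℤ using (+_; +≤+)
import Data.Integer.Properties as ℤ
open import Data.Rational.Base renaming (NonZero to NonZeroℚ)
open import Data.Rational.Properties
open import Data.Rational.Solver using (module +-*-Solver)
open import Data.Rational.Unnormalised.Base as ℚᵘ using (mkℚᵘ; *≡*; *≤*)
import Data.Rational.Unnormalised.Properties as ℚᵘ
open import Data.Fin.Base using (Fin)
import Data.Fin.Properties as Fin
open import Data.Fin.Subset using (Subset; _∈_; _∉_; ⊤) renaming (∣_∣ to ∣_∣ₛ)
open import Data.Fin.Subset.Properties using (_∈?_; anySubset?; ∈⊤; ∣⊤∣≡n)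
open import Data.Product.Base using (∃; ∃-syntax; _×_; _,_; proj₁; proj₂)
open import Data.Sum.Base using (inj₁; inj₂)
open import Function.Bundles using (_↔_; _⇔_; module Inverse)
open import Relation.Nullary using (yes; no; ¬_; contradiction; ¬?; _×-dec_; _→-dec_)
import Relation.Unary as U
open import Relation.Binary.Core using (Rel)
open import Relation.Binary.Definitions using (Decidable; Symmetric; Irreflexive)
open import Relation.Binary.PropositionalEquality
  using (_≡_; _≢_; refl; sym; trans; cong; cong₂; subst; subst₂; ≢-sym)

-- Finite simple graphs are decidable; without _~?_ a minimum over vertex
-- sets need not exist constructively.
record Graph (V : Set) : Set₁ where
  infix 4 _~_ _~?_
  field
    _~_    : Rel V 0ℓ
    _~?_   : Decidable _~_
    sym~   : Symmetric _~_
    irrefl : Irreflexive _≡_ _~_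

infix 4 _≅_

record _≅_ {V W : Set} (G : Graph V) (H : Graph W) : Set where
  private
    module G = Graph G
    module H = Graph H
  field
    vertices : V ↔ W
  open Inverse vertices using (to)
  field
    edges    : ∀ u v → (u G.~ v) ⇔ (to u H.~ to v)

K : ∀ r → Graph (Fin r)
K r = record
  { _~_    = _≢_
  ; _~?_   = λ u v → ¬? (u Fin.≟ v)
  ; sym~   = ≢-sym
  ; irrefl = λ u≡v u≢v → u≢v u≡v
  }

copies : ∀ m {V} → Graph V → Graph (Fin m × V)
copies m G = record
  { _~_    = λ { (i , u) (j , v) → i ≡ j × u ~ v }
  ; _~?_   = λ { (i , u) (j , v) → (i Fin.≟ j) ×-dec (u ~? v) }
  ; sym~   = λ { (i≡j , u~v) → sym i≡j , sym~ u~v }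
  ; irrefl = λ { refl (_ , u~u) → irrefl refl u~u }
  }
  where open Graph G

module _ {n k} (F : Fin k → Graph (Fin n)) where

  SimultaneouslyDominating : Subset n → Set
  SimultaneouslyDominating S =
    ∀ i v → v ∉ S → ∃[ u ] (u ∈ S × Graph._~_ (F i) v u)

  simultaneouslyDominating? : U.Decidable SimultaneouslyDominating
  simultaneouslyDominating? S = Fin.all? λ i → Fin.all? λ v →
    ¬? (v ∈? S) →-dec Fin.any? λ u → (u ∈? S) ×-dec Graph._~?_ (F i) v u

  HasDominatingSetOfSize : ℕ → Set
  HasDominatingSetOfSize m =
    ∃[ S ] (SimultaneouslyDominating S × ∣ S ∣ₛ ≡ m)

  hasDominatingSetOfSize? : U.Decidable HasDominatingSetOfSize
  hasDominatingSetOfSize? m = anySubset? λ S →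
    simultaneouslyDominating? S ×-dec (∣ S ∣ₛ ℕ.≟ m)

least : ∀ {P : ℕ → Set} → U.Decidable P → ∀ {n} → P n →
        ∃[ m ] (P m × (∀ {j} → P j → m ℕ.≤ j))
least P? {n} Pn with P? 0
... | yes P0 = 0 , P0 , λ _ → z≤n
least P? {zero}  Pn | no ¬P0 = contradiction Pn ¬P0
least {P} P? {suc n} Pn | no ¬P0
  with m , Pm , min ← least {λ j → P (suc j)} (λ j → P? (suc j)) Pn
  = suc m , Pm , λ { {zero} P0 → contradiction P0 ¬P0 ; {suc j} Pj → s≤s (min Pj) }

minimumDominatingSize : ∀ {n k} (F : Fin k → Graph (Fin n)) →
  ∃[ m ] (HasDominatingSetOfSize F m × (∀ {j} → HasDominatingSetOfSize F j → m ℕ.≤ j))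
minimumDominatingSize {n} F = least (hasDominatingSetOfSize? F)
  (⊤ , (λ _ v v∉⊤ → contradiction ∈⊤ v∉⊤) , ∣⊤∣≡n n)

γsd : ∀ {n k} → (Fin k → Graph (Fin n)) → ℕ
γsd F = proj₁ (minimumDominatingSize F)

-- Cauchy sequences of rationals, not quotiented: _≤ᴿ_ compares limits.
record ℝ : Set where
  constructor mkℝ
  field
    seq    : ℕ → ℚ
    cauchy : ∀ ε → 0ℚ < ε → ∃[ N ] (∀ {m n} → N ℕ.≤ m → N ℕ.≤ n → ∣ seq m - seq n ∣ ≤ ε)

open ℝ public

infix  4 _≤ᴿ_
infixl 6 _+ᴿ_ _-ᴿ_
infixl 7 _*ᴿ_ _/ᴿ_

_≤ᴿ_ : Rel ℝ 0ℓ
x ≤ᴿ y = ∀ ε → 0ℚ < ε → ∃[ N ] (∀ {n} → N ℕ.≤ n → seq x n ≤ seq y n + ε)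

fromℚ : ℚ → ℝ
fromℚ q = mkℝ (λ _ → q) λ ε 0<ε → 0 , λ _ _ →
  subst (_≤ ε) (sym (cong ∣_∣ (+-inverseʳ q))) (<⇒≤ 0<ε)

fromℕ : ℕ → ℝ
fromℕ n = fromℚ (+ n / 1)

half-pos : ∀ {ε} → 0ℚ < ε → 0ℚ < ½ * ε
half-pos {ε} 0<ε = subst (_< ½ * ε) (*-zeroʳ ½) (*-monoʳ-<-pos ½ 0<ε)

half+half : ∀ ε → ½ * ε + ½ * ε ≡ ε
half+half ε = trans (sym (*-distribʳ-+ ε ½ ½)) (*-identityˡ ε)

_+ᴿ_ : ℝ → ℝ → ℝ
x +ᴿ y = mkℝ (λ n → seq x n + seq y n) λ ε 0<ε →
  let M , p = cauchy x (½ * ε) (half-pos 0<ε)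
      N , q = cauchy y (½ * ε) (half-pos 0<ε)
  in M ℕ.⊔ N , λ {m} {n} ≤m ≤n → begin
    ∣ (seq x m + seq y m) - (seq x n + seq y n) ∣
      ≡⟨ cong ∣_∣ (regroup (seq x m) (seq y m) (seq x n) (seq y n)) ⟩
    ∣ (seq x m - seq x n) + (seq y m - seq y n) ∣
      ≤⟨ ∣p+q∣≤∣p∣+∣q∣ (seq x m - seq x n) (seq y m - seq y n) ⟩
    ∣ seq x m - seq x n ∣ + ∣ seq y m - seq y n ∣
      ≤⟨ +-mono-≤ (p (ℕ.m⊔n≤o⇒m≤o M N ≤m) (ℕ.m⊔n≤o⇒m≤o M N ≤n))
                  (q (ℕ.m⊔n≤o⇒n≤o M N ≤m) (ℕ.m⊔n≤o⇒n≤o M N ≤n)) ⟩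
    ½ * ε + ½ * ε
      ≡⟨ half+half ε ⟩
    ε ∎
  where
  open ≤-Reasoning
  open +-*-Solver
  regroup : ∀ a b c d → (a + b) - (c + d) ≡ (a - c) + (b - d)
  regroup = solve 4 (λ a b c d → (a :+ b) :- (c :+ d) := (a :- c) :+ (b :- d)) refl

-ᴿ_ : ℝ → ℝ
-ᴿ x = mkℝ (λ n → - seq x n) λ ε 0<ε →
  let N , p = cauchy x ε 0<ε
  in N , λ {m} {n} ≤m ≤n →
    subst (_≤ ε) (trans (sym (∣-p∣≡∣p∣ (seq x m - seq x n)))
                        (cong ∣_∣ (neg-distrib-+ (seq x m) (- seq x n))))
          (p ≤m ≤n)

_-ᴿ_ : ℝ → ℝ → ℝ
x -ᴿ y = x +ᴿ (-ᴿ y)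

eventuallyBounded : ∀ x → ∃[ B ] (0ℚ < B × ∃[ N ] (∀ {n} → N ℕ.≤ n → ∣ seq x n ∣ ≤ B))
eventuallyBounded x =
  let N , p = cauchy x 1ℚ (positive⁻¹ 1ℚ)
  in 1ℚ + ∣ seq x N ∣
   , +-mono-<-≤ (positive⁻¹ 1ℚ) (0≤∣p∣ (seq x N))
   , N , λ {n} ≤n → begin
       ∣ seq x n ∣                           ≡⟨ cong ∣_∣ (split (seq x n) (seq x N)) ⟩
       ∣ (seq x n - seq x N) + seq x N ∣     ≤⟨ ∣p+q∣≤∣p∣+∣q∣ (seq x n - seq x N) (seq x N) ⟩
       ∣ seq x n - seq x N ∣ + ∣ seq x N ∣   ≤⟨ +-monoˡ-≤ ∣ seq x N ∣ (p ≤n ℕ.≤-refl) ⟩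
       1ℚ + ∣ seq x N ∣                      ∎
  where
  open ≤-Reasoning
  open +-*-Solver
  split : ∀ a b → a ≡ (a - b) + b
  split = solve 2 (λ a b → a := (a :- b) :+ b) refl

∣∣-mono-* : ∀ {a b c d} → ∣ a ∣ ≤ c → ∣ b ∣ ≤ d → ∣ a * b ∣ ≤ c * d
∣∣-mono-* {a} {b} {c} {d} a≤c b≤d = begin
  ∣ a * b ∣      ≡⟨ ∣p*q∣≡∣p∣*∣q∣ a b ⟩
  ∣ a ∣ * ∣ b ∣  ≤⟨ *-monoʳ-≤-nonNeg ∣ b ∣ {{∣-∣-nonNeg b}} a≤c ⟩
  c * ∣ b ∣      ≤⟨ *-monoˡ-≤-nonNeg c {{nonNegative (≤-trans (0≤∣p∣ a) a≤c)}} b≤d ⟩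
  c * d          ∎
  where open ≤-Reasoning

quotient-pos : ∀ {B ε} → 0ℚ < B → 0ℚ < ε → ∃[ δ ] (0ℚ < δ × B * δ ≡ ε)
quotient-pos {B} {ε} 0<B 0<ε = δ , 0<δ , eq
  where
  instance
    posB : Positive B
    posB = positive 0<B
    nzB : NonZeroℚ B
    nzB = pos⇒nonZero B
  δ = 1/ B * ε
  0<δ : 0ℚ < δ
  0<δ = subst (_< δ) (*-zeroʳ (1/ B)) (*-monoʳ-<-pos (1/ B) {{1/pos⇒pos B}} 0<ε)
  eq : B * δ ≡ ε
  eq = trans (sym (*-assoc B (1/ B) ε))
             (trans (cong (_* ε) (*-inverseʳ B)) (*-identityˡ ε))

_*ᴿ_ : ℝ → ℝ → ℝ
x *ᴿ y = mkℝ (λ n → seq x n * seq y n) λ ε 0<ε →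
  let B , 0<B , L , b   = eventuallyBounded x
      C , 0<C , M , c   = eventuallyBounded y
      δ , 0<δ , [B+C]δ≡ε = quotient-pos (+-mono-< 0<B 0<C) 0<ε
      P , p = cauchy x δ 0<δ
      Q , q = cauchy y δ 0<δ
      N = (L ℕ.⊔ M) ℕ.⊔ (P ℕ.⊔ Q)
      L≤ : ∀ {n} → N ℕ.≤ n → L ℕ.≤ n
      L≤ h = ℕ.m⊔n≤o⇒m≤o L M (ℕ.m⊔n≤o⇒m≤o (L ℕ.⊔ M) (P ℕ.⊔ Q) h)
      M≤ : ∀ {n} → N ℕ.≤ n → M ℕ.≤ n
      M≤ h = ℕ.m⊔n≤o⇒n≤o L M (ℕ.m⊔n≤o⇒m≤o (L ℕ.⊔ M) (P ℕ.⊔ Q) h)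
      P≤ : ∀ {n} → N ℕ.≤ n → P ℕ.≤ n
      P≤ h = ℕ.m⊔n≤o⇒m≤o P Q (ℕ.m⊔n≤o⇒n≤o (L ℕ.⊔ M) (P ℕ.⊔ Q) h)
      Q≤ : ∀ {n} → N ℕ.≤ n → Q ℕ.≤ n
      Q≤ h = ℕ.m⊔n≤o⇒n≤o P Q (ℕ.m⊔n≤o⇒n≤o (L ℕ.⊔ M) (P ℕ.⊔ Q) h)
  in N , λ {m} {n} ≤m ≤n → begin
    ∣ seq x m * seq y m - seq x n * seq y n ∣
      ≡⟨ cong ∣_∣ (regroup (seq x m) (seq y m) (seq x n) (seq y n)) ⟩
    ∣ seq x m * (seq y m - seq y n) + seq y n * (seq x m - seq x n) ∣
      ≤⟨ ∣p+q∣≤∣p∣+∣q∣ (seq x m * (seq y m - seq y n)) (seq y n * (seq x m - seq x n)) ⟩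
    ∣ seq x m * (seq y m - seq y n) ∣ + ∣ seq y n * (seq x m - seq x n) ∣
      ≤⟨ +-mono-≤ (∣∣-mono-* {seq x m} {seq y m - seq y n} (b (L≤ ≤m)) (q (Q≤ ≤m) (Q≤ ≤n)))
                  (∣∣-mono-* {seq y n} {seq x m - seq x n} (c (M≤ ≤n)) (p (P≤ ≤m) (P≤ ≤n))) ⟩
    B * δ + C * δ
      ≡⟨ sym (*-distribʳ-+ δ B C) ⟩
    (B + C) * δ
      ≡⟨ [B+C]δ≡ε ⟩
    ε ∎
  where
  open ≤-Reasoning
  open +-*-Solver
  regroup : ∀ a b c d → a * b - c * d ≡ a * (b - d) + d * (a - c)
  regroup = solve 4 (λ a b c d → a :* b :- c :* d := a :* (b :- d) :+ d :* (a :- c)) refl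

_/ᴿ_ : ℝ → ∀ n .{{_ : NonZero n}} → ℝ
x /ᴿ n = x *ᴿ fromℚ (+ 1 / n)

/-mono-≤ : ∀ a b m n → a ℕ.* suc n ℕ.≤ b ℕ.* suc m → + a / suc m ≤ + b / suc n
/-mono-≤ a b m n h = toℚᵘ-cancel-≤
  (ℚᵘ.≤-respˡ-≃ (ℚᵘ.≃-sym (toℚᵘ-fromℚᵘ (mkℚᵘ (+ a) m)))
  (ℚᵘ.≤-respʳ-≃ (ℚᵘ.≃-sym (toℚᵘ-fromℚᵘ (mkℚᵘ (+ b) n)))
    (*≤* (subst₂ ℤ._≤_ (ℤ.pos-* a (suc n)) (ℤ.pos-* b (suc m)) (+≤+ h)))))

/-+ : ∀ a n → + a / suc n + + 1 / suc n ≡ + suc a / suc n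
/-+ a n = toℚᵘ-injective
  (ℚᵘ.≃-trans (toℚᵘ-homo-+ (+ a / suc n) (+ 1 / suc n))
  (ℚᵘ.≃-trans (ℚᵘ.+-cong (toℚᵘ-fromℚᵘ (mkℚᵘ (+ a) n)) (toℚᵘ-fromℚᵘ (mkℚᵘ (+ 1) n)))
  (ℚᵘ.≃-trans (*≡* same) (ℚᵘ.≃-sym (toℚᵘ-fromℚᵘ (mkℚᵘ (+ suc a) n))))))
  where
  nat : ∀ a b → (a ℕ.* b ℕ.+ 1 ℕ.* b) ℕ.* b ≡ (1 ℕ.+ a) ℕ.* (b ℕ.* b)
  nat = solve-∀
  same : ((+ a) ℤ.* (+ suc n) ℤ.+ (+ 1) ℤ.* (+ suc n)) ℤ.* (+ suc n)
       ≡ (+ suc a) ℤ.* (+ (suc n ℕ.* suc n))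
  same rewrite sym (ℤ.pos-* a (suc n)) | sym (ℤ.pos-* 1 (suc n))
             | sym (ℤ.pos-* (a ℕ.* suc n ℕ.+ 1 ℕ.* suc n) (suc n))
             | sym (ℤ.pos-* (suc a) (suc n ℕ.* suc n))
    = cong +_ (nat a (suc n))

1/suc : ℕ → ℚ
1/suc n = + 1 / suc n

1/suc-anti : ∀ {m n} → m ℕ.≤ n → 1/suc n ≤ 1/suc m
1/suc-anti {m} {n} m≤n = /-mono-≤ 1 1 n m (ℕ.*-monoʳ-≤ 1 (s≤s m≤n))

1/suc-double : ∀ n → 1/suc n ≡ 1/suc (suc (n ℕ.+ n)) + 1/suc (suc (n ℕ.+ n))
1/suc-double n = trans
  (≤-antisym (/-mono-≤ 1 2 n (suc (n ℕ.+ n)) (ℕ.≤-reflexive (eq n)))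
             (/-mono-≤ 2 1 (suc (n ℕ.+ n)) n (ℕ.≤-reflexive (sym (eq n)))))
  (sym (/-+ 1 (suc (n ℕ.+ n))))
  where
  eq : ∀ n → 1 ℕ.* (2 ℕ.+ (n ℕ.+ n)) ≡ 2 ℕ.* (1 ℕ.+ n)
  eq = solve-∀

archimedean : ∀ ε → 0ℚ < ε → ∃[ N ] (1/suc N ≤ ε)
archimedean ε@(mkℚ (+ suc a) d _) 0<ε = d , subst (1/suc d ≤_) (fromℚᵘ-toℚᵘ ε)
  (/-mono-≤ 1 (suc a) d d (ℕ.*-monoˡ-≤ (suc d) (s≤s (z≤n {a}))))
archimedean (mkℚ (+ zero) d _) (*<* (ℤ.+<+ ()))
archimedean (mkℚ ℤ.-[1+ a ] d _) (*<* ())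

∣-∣-≤ : ∀ {a b e} → a ≤ b + e → b ≤ a + e → ∣ a - b ∣ ≤ e
∣-∣-≤ {a} {b} {e} p q with ∣p∣≡p∨∣p∣≡-p (a - b)
... | inj₁ eq = subst (_≤ e) (sym eq)
                  (subst (a - b ≤_) (cancel b e) (+-monoˡ-≤ (- b) p))
  where
  open +-*-Solver
  cancel : ∀ b e → (b + e) - b ≡ e
  cancel = solve 2 (λ b e → (b :+ e) :- b := e) refl
... | inj₂ eq = subst (_≤ e) (sym (trans eq (flip-sub a b)))
                  (subst (b - a ≤_) (cancel a e) (+-monoˡ-≤ (- a) q))
  where
  open +-*-Solver
  cancel : ∀ b e → (b + e) - b ≡ e
  cancel = solve 2 (λ b e → (b :+ e) :- b := e) refl
  flip-sub : ∀ a b → - (a - b) ≡ b - a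
  flip-sub = solve 2 (λ a b → :- (a :- b) := b :- a) refl

-- The greatest a ≤ b satisfying P, or 0 if there is none.
greatest : ∀ {P : ℕ → Set} → U.Decidable P → ℕ → ℕ
greatest P? zero    = 0
greatest P? (suc b) with P? (suc b)
... | yes _ = suc b
... | no  _ = greatest P? b

greatest-holds : ∀ {P : ℕ → Set} (P? : U.Decidable P) b → P 0 → P (greatest P? b)
greatest-holds P? zero    P0 = P0
greatest-holds P? (suc b) P0 with P? (suc b)
... | yes Pb = Pb
... | no  _  = greatest-holds P? b P0

greatest-fails : ∀ {P : ℕ → Set} (P? : U.Decidable P) b → ¬ P (suc b) →
                 ¬ P (suc (greatest P? b))
greatest-fails P? zero    ¬P = ¬P
greatest-fails P? (suc b) ¬P with P? (suc b)
... | yes _  = ¬P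
... | no ¬P′ = greatest-fails P? b ¬P′

-- ⟨ p / q ⟩^1/ m is the nonnegative m-th root of p / q.  Its n-th
-- approximation is the greatest multiple a / (n + 1) of 1 / (n + 1) with
-- (a / (n + 1))^m ≤ p / q; such a never exceed (p + 1)(n + 1).

module Root (p q m : ℕ) where

  Below : ℕ → ℕ → Set
  Below n a = a ℕ.^ m ℕ.* q ℕ.≤ p ℕ.* suc n ℕ.^ m

  below? : ∀ n → U.Decidable (Below n)
  below? n a = a ℕ.^ m ℕ.* q ℕ.≤? p ℕ.* suc n ℕ.^ m

  numer : ℕ → ℕ
  numer n = greatest (below? n) (suc p ℕ.* suc n)

  approx : ℕ → ℚ
  approx n = + numer n / suc n

  module _ .{{_ : NonZero q}} .{{_ : NonZero m}} where

    0^ : ∀ m .{{_ : NonZero m}} → 0 ℕ.^ m ≡ 0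
    0^ (suc m) = refl

    m≤m^ : ∀ a m .{{_ : NonZero m}} .{{_ : NonZero a}} → a ℕ.≤ a ℕ.^ m
    m≤m^ a (suc m) = ℕ.m≤m*n a (a ℕ.^ m) {{ℕ.m^n≢0 a m}}

    ^-*-comm : ∀ a b m → (a ℕ.* b) ℕ.^ m ≡ a ℕ.^ m ℕ.* b ℕ.^ m
    ^-*-comm a b zero    = refl
    ^-*-comm a b (suc m) rewrite ^-*-comm a b m = shuffle a b (a ℕ.^ m) (b ℕ.^ m)
      where
      shuffle : ∀ a b x y → a ℕ.* b ℕ.* (x ℕ.* y) ≡ a ℕ.* x ℕ.* (b ℕ.* y)
      shuffle = solve-∀

    below-0 : ∀ n → Below n 0
    below-0 n = subst (λ z → z ℕ.* q ℕ.≤ p ℕ.* suc n ℕ.^ m) (sym (0^ m)) z≤n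

    ¬below-bound : ∀ n → ¬ Below n (suc (suc p ℕ.* suc n))
    ¬below-bound n h = ℕ.<⇒≱ (ℕ.<-≤-trans lt (ℕ.m≤m*n _ q)) h
      where
      lt : p ℕ.* suc n ℕ.^ m ℕ.< suc (suc p ℕ.* suc n) ℕ.^ m
      lt = ℕ.<-≤-trans
        (ℕ.*-monoˡ-< (suc n ℕ.^ m) {{ℕ.m^n≢0 (suc n) m}} (ℕ.n<1+n p))
        (ℕ.≤-trans (ℕ.*-monoˡ-≤ (suc n ℕ.^ m) (m≤m^ (suc p) m))
        (ℕ.≤-trans (ℕ.≤-reflexive (sym (^-*-comm (suc p) (suc n) m)))
                   (ℕ.^-monoˡ-≤ m (ℕ.n≤1+n (suc p ℕ.* suc n)))))

    cross : ∀ i j → numer i ℕ.* suc j ℕ.≤ suc (numer j) ℕ.* suc i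
    cross i j with numer i ℕ.* suc j ℕ.≤? suc (numer j) ℕ.* suc i
    ... | yes h = h
    ... | no ¬h = contradiction chain (ℕ.<-irrefl refl)
      where
      open ℕ.≤-Reasoning
      a = numer i
      b = suc (numer j)
      I = suc i ℕ.^ m
      J = suc j ℕ.^ m
      sw₁ : ∀ x y z → x ℕ.* y ℕ.* z ≡ x ℕ.* z ℕ.* y
      sw₁ = solve-∀
      chain : p ℕ.* J ℕ.* I ℕ.< p ℕ.* J ℕ.* I
      chain = begin-strict
        p ℕ.* J ℕ.* I                  <⟨ ℕ.*-monoˡ-< I {{ℕ.m^n≢0 (suc i) m}}
                                            (ℕ.≰⇒> (greatest-fails (below? j) _ (¬below-bound j))) ⟩
        b ℕ.^ m ℕ.* q ℕ.* I            ≡⟨ sw₁ (b ℕ.^ m) q I ⟩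
        b ℕ.^ m ℕ.* I ℕ.* q            ≡⟨ cong (ℕ._* q) (sym (^-*-comm b (suc i) m)) ⟩
        (b ℕ.* suc i) ℕ.^ m ℕ.* q      ≤⟨ ℕ.*-monoˡ-≤ q (ℕ.^-monoˡ-≤ m (ℕ.<⇒≤ (ℕ.≰⇒> ¬h))) ⟩
        (a ℕ.* suc j) ℕ.^ m ℕ.* q      ≡⟨ cong (ℕ._* q) (^-*-comm a (suc j) m) ⟩
        a ℕ.^ m ℕ.* J ℕ.* q            ≡⟨ sw₁ (a ℕ.^ m) J q ⟩
        a ℕ.^ m ℕ.* q ℕ.* J            ≤⟨ ℕ.*-monoˡ-≤ J (greatest-holds (below? i) _ (below-0 i)) ⟩
        p ℕ.* I ℕ.* J                  ≡⟨ sw₁ p I J ⟩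
        p ℕ.* J ℕ.* I                  ∎

    approx-≤ : ∀ i j → approx i ≤ approx j + 1/suc j
    approx-≤ i j = subst (approx i ≤_) (sym (/-+ (numer j) j))
                     (/-mono-≤ (numer i) (suc (numer j)) i j (cross i j))

    approx-cauchy : ∀ ε → 0ℚ < ε →
      ∃[ N ] (∀ {i j} → N ℕ.≤ i → N ℕ.≤ j → ∣ approx i - approx j ∣ ≤ ε)
    approx-cauchy ε 0<ε =
      let N , 1/N≤ε = archimedean ε 0<ε
          bound : ∀ i {j} → N ℕ.≤ j → approx i ≤ approx j + ε
          bound i {j} N≤j = ≤-trans (approx-≤ i j)
            (+-monoʳ-≤ (approx j) (≤-trans (1/suc-anti N≤j) 1/N≤ε))
      in N , λ {i} {j} N≤i N≤j → ∣-∣-≤ (bound i N≤j) (bound j N≤i)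

⟨_/_⟩^1/_ : ∀ p q .{{_ : NonZero q}} m .{{_ : NonZero m}} → ℝ
⟨ p / q ⟩^1/ m = mkℝ (Root.approx p q m) (Root.approx-cauchy p q m)

sum< : ℕ → (ℕ → ℚ) → ℚ
sum< zero    f = 0ℚ
sum< (suc n) f = sum< n f + f n

-- ln k = ∫₁ᵏ dt / t is the limit of the lower Riemann sums.  Both sums below
-- use a partition of [1 , k] into intervals of length 1 / 2ⁿ: the
-- right endpoint of the i-th interval is (2ⁿ + i + 1) / 2ⁿ, so it contributes
-- 2⁻ⁿ · 2ⁿ / (2ⁿ + i + 1) to the lower sum, and 2⁻ⁿ · 2ⁿ / (2ⁿ + i) to the
-- upper one.

pieces : ℕ → ℕ → ℕ
pieces k n = (k ℕ.∸ 1) ℕ.* 2 ℕ.^ n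

lowerSum : ℕ → ℕ → ℚ
lowerSum k n = sum< (pieces k n) λ i → 1/suc (2 ℕ.^ n ℕ.+ i)

upperSum : ℕ → ℕ → ℚ
upperSum k n = sum< (pieces k n) λ i → 1/suc (ℕ.pred (2 ℕ.^ n) ℕ.+ i)

open ≤-Reasoning

refine-lower : ∀ M t → sum< t (λ i → 1/suc (suc M ℕ.+ i))
             ≤ sum< (t ℕ.+ t) (λ i → 1/suc (suc M ℕ.+ suc M ℕ.+ i))
refine-lower M zero    = ≤-refl
refine-lower M (suc t) rewrite ℕ.+-suc t t = begin
  sum< t (λ i → 1/suc (suc M ℕ.+ i)) + 1/suc (suc M ℕ.+ t)
    ≤⟨ +-monoˡ-≤ _ (refine-lower M t) ⟩
  s + 1/suc (suc M ℕ.+ t)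
    ≡⟨ cong (λ z → s + z) (1/suc-double (suc M ℕ.+ t)) ⟩
  s + (1/suc (suc d) + 1/suc (suc d))
    ≡⟨ sym (+-assoc s _ _) ⟩
  (s + 1/suc (suc d)) + 1/suc (suc d)
    ≤⟨ +-mono-≤ (+-monoʳ-≤ s (1/suc-anti (ℕ.≤-trans (ℕ.≤-reflexive (e₁ M t)) (ℕ.n≤1+n d))))
                (1/suc-anti (ℕ.≤-reflexive (e₂ M t))) ⟩
  s + 1/suc (suc M ℕ.+ suc M ℕ.+ (t ℕ.+ t)) + 1/suc (suc M ℕ.+ suc M ℕ.+ suc (t ℕ.+ t)) ∎
  where
  s = sum< (t ℕ.+ t) (λ i → 1/suc (suc M ℕ.+ suc M ℕ.+ i))
  d = (suc M ℕ.+ t) ℕ.+ (suc M ℕ.+ t)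
  e₁ : ∀ M t → (1 ℕ.+ M) ℕ.+ (1 ℕ.+ M) ℕ.+ (t ℕ.+ t) ≡ ((1 ℕ.+ M) ℕ.+ t) ℕ.+ ((1 ℕ.+ M) ℕ.+ t)
  e₁ = solve-∀
  e₂ : ∀ M t → (1 ℕ.+ M) ℕ.+ (1 ℕ.+ M) ℕ.+ (1 ℕ.+ (t ℕ.+ t))
             ≡ 1 ℕ.+ (((1 ℕ.+ M) ℕ.+ t) ℕ.+ ((1 ℕ.+ M) ℕ.+ t))
  e₂ = solve-∀

refine-upper : ∀ M t → sum< (t ℕ.+ t) (λ i → 1/suc (M ℕ.+ suc M ℕ.+ i))
             ≤ sum< t (λ i → 1/suc (M ℕ.+ i))
refine-upper M zero    = ≤-refl
refine-upper M (suc t) rewrite ℕ.+-suc t t = begin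
  s + 1/suc (M ℕ.+ suc M ℕ.+ (t ℕ.+ t)) + 1/suc (M ℕ.+ suc M ℕ.+ suc (t ℕ.+ t))
    ≤⟨ +-mono-≤ (+-monoʳ-≤ s (1/suc-anti (ℕ.≤-reflexive (e₁ M t))))
                (1/suc-anti (ℕ.≤-trans (ℕ.n≤1+n (suc d)) (ℕ.≤-reflexive (e₂ M t)))) ⟩
  (s + 1/suc (suc d)) + 1/suc (suc d)
    ≡⟨ +-assoc s _ _ ⟩
  s + (1/suc (suc d) + 1/suc (suc d))
    ≡⟨ cong (λ z → s + z) (sym (1/suc-double (M ℕ.+ t))) ⟩
  s + 1/suc (M ℕ.+ t)
    ≤⟨ +-monoˡ-≤ _ (refine-upper M t) ⟩
  sum< t (λ i → 1/suc (M ℕ.+ i)) + 1/suc (M ℕ.+ t) ∎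
  where
  s = sum< (t ℕ.+ t) (λ i → 1/suc (M ℕ.+ suc M ℕ.+ i))
  d = (M ℕ.+ t) ℕ.+ (M ℕ.+ t)
  e₁ : ∀ M t → 1 ℕ.+ ((M ℕ.+ t) ℕ.+ (M ℕ.+ t)) ≡ M ℕ.+ (1 ℕ.+ M) ℕ.+ (t ℕ.+ t)
  e₁ = solve-∀
  e₂ : ∀ M t → 2 ℕ.+ ((M ℕ.+ t) ℕ.+ (M ℕ.+ t)) ≡ M ℕ.+ (1 ℕ.+ M) ℕ.+ (1 ℕ.+ (t ℕ.+ t))
  e₂ = solve-∀

0≤1/suc : ∀ n → 0ℚ ≤ 1/suc n
0≤1/suc n = /-mono-≤ 0 1 0 n z≤n

telescope : ∀ M t → sum< t (λ i → 1/suc (M ℕ.+ i)) + 1/suc (M ℕ.+ t)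
          ≡ sum< t (λ i → 1/suc (suc M ℕ.+ i)) + 1/suc M
telescope M zero    = cong (λ z → 0ℚ + 1/suc z) (ℕ.+-identityʳ M)
telescope M (suc t) = begin-equality
  (sum< t (λ i → 1/suc (M ℕ.+ i)) + 1/suc (M ℕ.+ t)) + 1/suc (M ℕ.+ suc t)
    ≡⟨ cong₂ _+_ (telescope M t) (cong 1/suc (ℕ.+-suc M t)) ⟩
  (l + 1/suc M) + 1/suc (suc M ℕ.+ t)
    ≡⟨ swap l (1/suc M) (1/suc (suc M ℕ.+ t)) ⟩
  (l + 1/suc (suc M ℕ.+ t)) + 1/suc M ∎
  where
  open +-*-Solver
  l = sum< t (λ i → 1/suc (suc M ℕ.+ i))
  swap : ∀ a b c → (a + b) + c ≡ (a + c) + b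
  swap = solve 3 (λ a b c → (a :+ b) :+ c := (a :+ c) :+ b) refl

sum<-mono : ∀ t {f g : ℕ → ℚ} → (∀ i → f i ≤ g i) → sum< t f ≤ sum< t g
sum<-mono zero    h = ≤-refl
sum<-mono (suc t) h = +-mono-≤ (sum<-mono t h) (h t)

2^-suc : ∀ n → ∃[ M ] (2 ℕ.^ n ≡ suc M)
2^-suc n with 2 ℕ.^ n | ℕ.m^n≢0 2 n
... | suc M | _ = M , refl

pieces-double : ∀ k n → pieces k (suc n) ≡ pieces k n ℕ.+ pieces k n
pieces-double k n = eq (k ℕ.∸ 1) (2 ℕ.^ n)
  where
  eq : ∀ a b → a ℕ.* (2 ℕ.* b) ≡ a ℕ.* b ℕ.+ a ℕ.* b
  eq = solve-∀

n<2^n : ∀ n → n ℕ.< 2 ℕ.^ n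
n<2^n zero    = s≤s z≤n
n<2^n (suc n) = ℕ.<-≤-trans (s≤s (n<2^n n))
  (ℕ.≤-trans (ℕ.+-monoˡ-≤ (2 ℕ.^ n) (ℕ.>-nonZero⁻¹ (2 ℕ.^ n) {{ℕ.m^n≢0 2 n}}))
             (ℕ.≤-reflexive (cong (2 ℕ.^ n ℕ.+_) (sym (ℕ.+-identityʳ (2 ℕ.^ n))))))

module _ (k : ℕ) where

  lower-step : ∀ n → lowerSum k n ≤ lowerSum k (suc n)
  lower-step n rewrite pieces-double k n | ℕ.+-identityʳ (2 ℕ.^ n) with 2 ℕ.^ n | 2^-suc n
  ... | _ | M , refl = refine-lower M ((k ℕ.∸ 1) ℕ.* suc M)

  upper-step : ∀ n → upperSum k (suc n) ≤ upperSum k n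
  upper-step n rewrite pieces-double k n | ℕ.+-identityʳ (2 ℕ.^ n) with 2 ℕ.^ n | 2^-suc n
  ... | _ | M , refl = refine-upper M ((k ℕ.∸ 1) ℕ.* suc M)

  lower-mono : ∀ {m n} → m ℕ.≤′ n → lowerSum k m ≤ lowerSum k n
  lower-mono (ℕ.≤′-reflexive refl) = ≤-refl
  lower-mono (ℕ.≤′-step {n} h)     = ≤-trans (lower-mono h) (lower-step n)

  upper-anti : ∀ {m n} → m ℕ.≤′ n → upperSum k n ≤ upperSum k m
  upper-anti (ℕ.≤′-reflexive refl) = ≤-refl
  upper-anti (ℕ.≤′-step {n} h)     = ≤-trans (upper-step n) (upper-anti h)

  lower≤upper : ∀ n → lowerSum k n ≤ upperSum k n
  lower≤upper n = sum<-mono (pieces k n) λ i →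
    1/suc-anti (ℕ.+-monoˡ-≤ i (ℕ.pred[n]≤n {2 ℕ.^ n}))

  gap : ∀ n → upperSum k n ≤ lowerSum k n + 1/suc n
  gap n with 2 ℕ.^ n | 2^-suc n | n<2^n n
  ... | _ | M , refl | s≤s n≤M = begin
    u                        ≡⟨ sym (+-identityʳ u) ⟩
    u + 0ℚ                   ≤⟨ +-monoʳ-≤ u (0≤1/suc (M ℕ.+ t)) ⟩
    u + 1/suc (M ℕ.+ t)      ≡⟨ telescope M t ⟩
    l + 1/suc M              ≤⟨ +-monoʳ-≤ l (1/suc-anti n≤M) ⟩
    l + 1/suc n              ∎
    where
    t = (k ℕ.∸ 1) ℕ.* suc M
    u = sum< t (λ i → 1/suc (M ℕ.+ i))
    l = sum< t (λ i → 1/suc (suc M ℕ.+ i))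

lowerSum-cauchy : ∀ k ε → 0ℚ < ε →
  ∃[ N ] (∀ {m n} → N ℕ.≤ m → N ℕ.≤ n → ∣ lowerSum k m - lowerSum k n ∣ ≤ ε)
lowerSum-cauchy k ε 0<ε =
  let N , 1/N≤ε = archimedean ε 0<ε
      bound : ∀ {m n} → N ℕ.≤ m → N ℕ.≤ n → lowerSum k m ≤ lowerSum k n + ε
      bound {m} {n} N≤m N≤n = begin
        lowerSum k m            ≤⟨ lower≤upper k m ⟩
        upperSum k m            ≤⟨ upper-anti k (ℕ.≤⇒≤′ N≤m) ⟩
        upperSum k N            ≤⟨ gap k N ⟩
        lowerSum k N + 1/suc N  ≤⟨ +-mono-≤ (lower-mono k (ℕ.≤⇒≤′ N≤n)) 1/N≤ε ⟩
        lowerSum k n + ε        ∎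
  in N , λ N≤m N≤n → ∣-∣-≤ (bound N≤m N≤n) (bound N≤n N≤m)

ln : ∀ k .{{_ : NonZero k}} → ℝ
ln k = mkℝ (lowerSum k) (lowerSum-cauchy k)

{-# OPTIONS --safe #-}
module Submission where

-- First inequality: put each vertex into S independently with probability
-- 1 − x, and add one vertex of every copy of K_r that S misses.  The result is
-- simultaneously dominating and has expected size (1 − x) n + k (n / r) xʳ.
-- If x is at most the root of 1 / k, then k xʳ ≤ x, and the expectation is at
-- most the bound with x in place of the root.  The approximations of the root
-- approach it from below, so this holds for each of them, without a limit.
--
-- Second inequality: for s = r − 1 it says that s (1 − k^(-1/s)) ≤ ln k, which
-- even holds with any upper Riemann sum H = Σ 1 / (M + i) of ln k in place of
-- ln k: the product of the factors 1 + 1 / (M + i) telescopes to k, and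
-- Bernoulli's inequality yields (s − H)ˢ k ≤ sˢ.

open import Defs

module Domination where

  open import Data.Nat.Base using (ℕ; zero; suc; NonZero; _+_; _*_; _^_; _≤_; z≤n; s≤s; >-nonZero⁻¹)
  open import Data.Nat.Properties
  open import Data.Nat.Tactic.RingSolver using (solve-∀)
  open import Data.Fin.Base using (Fin; zero; suc; combine; remQuot; fromℕ<)
  import Data.Fin.Properties as Fin
  open import Data.Fin.Subset using (Subset; inside; outside; _∈_; _⊆_; _∪_; _-_; ∣_∣; ⁅_⁆; Nonempty)
  open import Data.Fin.Subset.Properties
    using (p⊆p∪q; q⊆p∪q; x∈⁅x⁆; ∣⁅x⁆∣≡1; x∈p⇒∣p-x∣<∣p∣; x∈p∧x≢y⇒x∈p-y)
  open import Data.List.Base using (List; []; _∷_; length; tabulate)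
  open import Data.List.Properties using (length-tabulate)
  open import Data.List.Membership.Propositional using () renaming (_∈_ to _∈ᴸ_)
  open import Data.List.Membership.Propositional.Properties using (∈-tabulate⁺)
  open import Data.List.Relation.Unary.All as All using (All; []; _∷_)
  import Data.List.Relation.Unary.All.Properties as All
  open import Data.Vec.Base using ([]; _∷_; here; there)
  import Data.Vec.Base as Vec
  import Data.Vec.Properties as Vec
  open import Data.Product.Base using (∃-syntax; _×_; _,_; proj₁; proj₂; uncurry)
  open import Data.Sum.Base using (_⊎_; inj₁; inj₂)
  open import Function.Base using (_∘_)
  open import Function.Bundles using (module Inverse; module Equivalence)
  open import Function.Definitions using (Injective)
  open import Relation.Nullary using (does; yes; no)
  open import Relation.Nullary.Decidable using (dec-true)
  open import Relation.Binary.PropositionalEquality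

  open ≤-Reasoning

  -- Sizes of subsets, and extension of a set to a transversal of a family.

  ∣p∪q∣≤∣p∣+∣q∣ : ∀ {n} (p q : Subset n) → ∣ p ∪ q ∣ ≤ ∣ p ∣ + ∣ q ∣
  ∣p∪q∣≤∣p∣+∣q∣ []            []            = z≤n
  ∣p∪q∣≤∣p∣+∣q∣ (outside ∷ p) (outside ∷ q) = ∣p∪q∣≤∣p∣+∣q∣ p q
  ∣p∪q∣≤∣p∣+∣q∣ (inside  ∷ p) (outside ∷ q) = s≤s (∣p∪q∣≤∣p∣+∣q∣ p q)
  ∣p∪q∣≤∣p∣+∣q∣ (outside ∷ p) (inside  ∷ q) =
    ≤-trans (s≤s (∣p∪q∣≤∣p∣+∣q∣ p q)) (≤-reflexive (sym (+-suc ∣ p ∣ ∣ q ∣)))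
  ∣p∪q∣≤∣p∣+∣q∣ (inside  ∷ p) (inside  ∷ q) =
    s≤s (≤-trans (∣p∪q∣≤∣p∣+∣q∣ p q) (+-monoʳ-≤ ∣ p ∣ (n≤1+n ∣ q ∣)))

  injection⇒≤∣p∣ : ∀ {m n} (p : Subset n) (f : Fin m → Fin n) → Injective _≡_ _≡_ f →
                   (∀ i → f i ∈ p) → m ≤ ∣ p ∣
  injection⇒≤∣p∣ {zero}  p f inj f∈p = z≤n
  injection⇒≤∣p∣ {suc m} p f inj f∈p = ≤-<-trans
    (injection⇒≤∣p∣ (p - f zero) (f ∘ suc) (Fin.suc-injective ∘ inj)
      (λ i → x∈p∧x≢y⇒x∈p-y (f∈p (suc i)) λ eq → Fin.0≢1+n (sym (inj eq))))
    (x∈p⇒∣p-x∣<∣p∣ (f∈p zero))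

  -- The indicator of `T` ∩ `S` = ∅, by recursion on coordinates so that it unfolds in step with the
  -- expectation below.
  miss : ∀ {n} → Subset n → Subset n → ℕ
  miss []            []            = 1
  miss (inside  ∷ T) (inside  ∷ S) = 0
  miss (inside  ∷ T) (outside ∷ S) = miss T S
  miss (outside ∷ T) (_       ∷ S) = miss T S

  misses : ∀ {n} → List (Subset n) → Subset n → ℕ
  misses []       S = 0
  misses (T ∷ Ts) S = miss T S + misses Ts S

  Meets : ∀ {n} → Subset n → Subset n → Set
  Meets T S = ∃[ u ] (u ∈ T × u ∈ S)

  meets-there : ∀ {n x y} {T S : Subset n} → Meets T S → Meets (x ∷ T) (y ∷ S)
  meets-there (u , u∈T , u∈S) = suc u , there u∈T , there u∈S

  meets⊎miss : ∀ {n} (T S : Subset n) → Meets T S ⊎ miss T S ≡ 1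
  meets⊎miss []            []            = inj₂ refl
  meets⊎miss (inside  ∷ T) (inside  ∷ S) = inj₁ (zero , here , here)
  meets⊎miss (inside  ∷ T) (outside ∷ S) with meets⊎miss T S
  ... | inj₁ meets = inj₁ (meets-there meets)
  ... | inj₂ eq    = inj₂ eq
  meets⊎miss (outside ∷ T) (_ ∷ S) with meets⊎miss T S
  ... | inj₁ meets = inj₁ (meets-there meets)
  ... | inj₂ eq    = inj₂ eq

  -- Each set of the family that `S` misses pays for one element of its own, added to `S`.
  extend-to-transversal : ∀ {n} (S : Subset n) {Ts} → All Nonempty Ts →
    ∃[ D ] (S ⊆ D × All (λ T → Meets T D) Ts × ∣ D ∣ ≤ ∣ S ∣ + misses Ts S)
  extend-to-transversal S [] = S , (λ x∈S → x∈S) , [] , m≤m+n ∣ S ∣ 0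
  extend-to-transversal S {T ∷ Ts} ((t , t∈T) ∷ nonempty)
    with D , S⊆D , meets , ∣D∣≤ ← extend-to-transversal S nonempty
    -- The test is against `S`, not `D`, because `misses` counts with respect to `S`; an element may
    -- thus be added for a `T` that `D` meets already.
    with meets⊎miss T S
  ... | inj₁ (u , u∈T , u∈S) =
        D , S⊆D , (u , u∈T , S⊆D u∈S) ∷ meets ,
        ≤-trans ∣D∣≤ (+-monoʳ-≤ ∣ S ∣ (m≤n+m (misses Ts S) (miss T S)))
  ... | inj₂ eq =
        D ∪ ⁅ t ⁆ , (p⊆p∪q ⁅ t ⁆ ∘ S⊆D) ,
        (t , t∈T , q⊆p∪q D ⁅ t ⁆ (x∈⁅x⁆ t)) ∷
          All.map (λ { (u , u∈T , u∈D) → u , u∈T , p⊆p∪q ⁅ t ⁆ u∈D }) meets ,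
        (begin
          ∣ D ∪ ⁅ t ⁆ ∣                     ≤⟨ ∣p∪q∣≤∣p∣+∣q∣ D ⁅ t ⁆ ⟩
          ∣ D ∣ + ∣ ⁅ t ⁆ ∣                 ≡⟨ cong (∣ D ∣ +_) (trans (∣⁅x⁆∣≡1 t) (sym eq)) ⟩
          ∣ D ∣ + miss T S                  ≤⟨ +-monoˡ-≤ (miss T S) ∣D∣≤ ⟩
          ∣ S ∣ + misses Ts S + miss T S    ≡⟨ +-assoc ∣ S ∣ _ _ ⟩
          ∣ S ∣ + (misses Ts S + miss T S)  ≡⟨ cong (∣ S ∣ +_) (+-comm (misses Ts S) _) ⟩
          ∣ S ∣ + (miss T S + misses Ts S)  ∎)

  -- Expectations over a random subset, scaled to natural numbers.

  -- 𝔼 f is (a + b)ⁿ times the expectation of f at the random subset that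
  -- contains each element independently with probability b / (a + b).

  module _ (a b : ℕ) where

    private N = a + b

    𝔼 : ∀ {n} → (Subset n → ℕ) → ℕ
    𝔼 {zero}  f = f []
    𝔼 {suc n} f = b * 𝔼 (λ S → f (inside ∷ S)) + a * 𝔼 (λ S → f (outside ∷ S))

    private
      split : ∀ a b x y → (a + b) * x * y ≡ b * (x * y) + a * (x * y)
      split = solve-∀

    -- Some value is at most the average: of the two recursive witnesses, the one with the smaller
    -- value is good for both halves of the weighted sum.
    ∃≤𝔼 : ∀ {n} (f : Subset n → ℕ) → ∃[ S ] (N ^ n * f S ≤ 𝔼 f)
    ∃≤𝔼 {zero}  f = [] , ≤-reflexive (*-identityˡ (f []))
    ∃≤𝔼 {suc n} f
      with S , S≤ ← ∃≤𝔼 (λ S → f (inside ∷ S)) | T , T≤ ← ∃≤𝔼 (λ S → f (outside ∷ S))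
      with ≤-total (f (inside ∷ S)) (f (outside ∷ T))
    ... | inj₁ le = inside ∷ S , (begin
      N * N ^ n * f (inside ∷ S)  ≡⟨ split a b (N ^ n) _ ⟩
      b * (N ^ n * f (inside ∷ S)) + a * (N ^ n * f (inside ∷ S))
        ≤⟨ +-mono-≤ (*-monoʳ-≤ b S≤) (*-monoʳ-≤ a (≤-trans (*-monoʳ-≤ (N ^ n) le) T≤)) ⟩
      𝔼 f ∎)
    ... | inj₂ le = outside ∷ T , (begin
      N * N ^ n * f (outside ∷ T)  ≡⟨ split a b (N ^ n) _ ⟩
      b * (N ^ n * f (outside ∷ T)) + a * (N ^ n * f (outside ∷ T))
        ≤⟨ +-mono-≤ (*-monoʳ-≤ b (≤-trans (*-monoʳ-≤ (N ^ n) le) S≤)) (*-monoʳ-≤ a T≤) ⟩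
      𝔼 f ∎)

    𝔼-+ : ∀ {n} (f g : Subset n → ℕ) → 𝔼 (λ S → f S + g S) ≡ 𝔼 f + 𝔼 g
    𝔼-+ {zero}  f g = refl
    𝔼-+ {suc n} f g = trans
      (cong₂ (λ x y → b * x + a * y) (𝔼-+ (f ∘ (inside ∷_)) (g ∘ (inside ∷_)))
                                     (𝔼-+ (f ∘ (outside ∷_)) (g ∘ (outside ∷_))))
      (regroup a b (𝔼 (f ∘ (inside ∷_))) _ _ _)
      where
      regroup : ∀ a b x y z w → b * (x + y) + a * (z + w) ≡ (b * x + a * z) + (b * y + a * w)
      regroup = solve-∀

    𝔼-const : ∀ n c → 𝔼 {n} (λ _ → c) ≡ N ^ n * c
    𝔼-const zero    c = sym (*-identityˡ c)
    𝔼-const (suc n) c rewrite 𝔼-const n c = collect a b (N ^ n) c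
      where
      collect : ∀ a b x c → b * (x * c) + a * (x * c) ≡ (a + b) * x * c
      collect = solve-∀

    -- The expected size is `n * b` / `N`; the factor `N` on the left avoids the exponent n - 1.
    𝔼-size : ∀ n → N * 𝔼 {n} ∣_∣ ≡ n * b * N ^ n
    𝔼-size zero    = *-zeroʳ N
    𝔼-size (suc n) = begin-equality
      N * (b * 𝔼 {n} (λ S → 1 + ∣ S ∣) + a * 𝔼 {n} ∣_∣)
        ≡⟨ cong (λ z → N * (b * z + a * 𝔼 {n} ∣_∣))
                (trans (𝔼-+ {n} (λ _ → 1) ∣_∣) (cong (_+ 𝔼 {n} ∣_∣) (𝔼-const n 1))) ⟩
      N * (b * (N ^ n * 1 + 𝔼 {n} ∣_∣) + a * 𝔼 {n} ∣_∣)
        ≡⟨ expand a b (N ^ n) (𝔼 {n} ∣_∣) ⟩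
      N * (b * N ^ n) + N * (N * 𝔼 {n} ∣_∣)
        ≡⟨ cong (λ z → N * (b * N ^ n) + N * z) (𝔼-size n) ⟩
      N * (b * N ^ n) + N * (n * b * N ^ n)
        ≡⟨ collect n N b (N ^ n) ⟩
      suc n * b * (N * N ^ n) ∎
      where
      expand : ∀ a b x e → (a + b) * (b * (x * 1 + e) + a * e)
             ≡ (a + b) * (b * x) + (a + b) * ((a + b) * e)
      expand = solve-∀
      collect : ∀ n N b x → N * (b * x) + N * (n * b * x) ≡ (1 + n) * b * (N * x)
      collect = solve-∀

    -- The probability of missing `T` is (`a` / `N`) to the power `∣ T ∣`: an element of `T`
    -- contributes the factor `a`, any other coordinate the factor `N`. Once `r` elements are
    -- counted, the remaining ones use only `a` ≤ `N`.
    𝔼-miss : ∀ {n} r (T : Subset n) → r ≤ ∣ T ∣ → N ^ r * 𝔼 (miss T) ≤ a ^ r * N ^ n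
    𝔼-miss {zero}  zero    []           _ = ≤-refl
    𝔼-miss {suc n} zero    (inside ∷ T)  _
      -- The rewrites erase the summand of weight `b`, in which `S` contains the element and `miss`
      -- is 0.
      rewrite 𝔼-const (n) 0 | *-zeroʳ (N ^ n) | *-zeroʳ b = begin
      1 * (a * 𝔼 (miss T))        ≡⟨ shuffle a (𝔼 (miss T)) ⟩
      a * (1 * 𝔼 (miss T))        ≤⟨ *-mono-≤ (m≤m+n a b) (𝔼-miss 0 T z≤n) ⟩
      N * (1 * N ^ n)  ≡⟨ shuffle N (N ^ n) ⟨
      1 * (N * N ^ n)  ∎
      where
      shuffle : ∀ a e → 1 * (a * e) ≡ a * (1 * e)
      shuffle = solve-∀
    𝔼-miss {suc n} (suc r) (inside ∷ T) (s≤s r≤)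
      rewrite 𝔼-const (n) 0 | *-zeroʳ (N ^ n) | *-zeroʳ b = begin
      N * N ^ r * (a * 𝔼 (miss T))        ≡⟨ shuffle N (N ^ r) a (𝔼 (miss T)) ⟩
      N * a * (N ^ r * 𝔼 (miss T))        ≤⟨ *-monoʳ-≤ (N * a) (𝔼-miss r T r≤) ⟩
      N * a * (a ^ r * N ^ n)  ≡⟨ shuffle′ N a (a ^ r) (N ^ n) ⟩
      a * a ^ r * (N * N ^ n)  ∎
      where
      shuffle : ∀ N x a e → N * x * (a * e) ≡ N * a * (x * e)
      shuffle = solve-∀
      shuffle′ : ∀ N a x y → N * a * (x * y) ≡ a * x * (N * y)
      shuffle′ = solve-∀
    𝔼-miss {suc n} r (outside ∷ T) r≤ = begin
      N ^ r * (b * 𝔼 (miss T) + a * 𝔼 (miss T))  ≡⟨ collect a b (N ^ r) (𝔼 (miss T)) ⟩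
      N * (N ^ r * 𝔼 (miss T))                   ≤⟨ *-monoʳ-≤ N (𝔼-miss r T r≤) ⟩
      N * (a ^ r * N ^ n)             ≡⟨ shuffle N (a ^ r) (N ^ n) ⟩
      a ^ r * (N * N ^ n)             ∎
      where
      collect : ∀ a b x e → x * (b * e + a * e) ≡ (a + b) * (x * e)
      collect = solve-∀
      shuffle : ∀ N x y → N * (x * y) ≡ x * (N * y)
      shuffle = solve-∀

    𝔼-misses : ∀ {n} r (Ts : List (Subset n)) → All (λ T → r ≤ ∣ T ∣) Ts →
               N ^ r * 𝔼 (misses Ts) ≤ length Ts * (a ^ r * N ^ n)
    𝔼-misses {n} r []       []         =
      ≤-reflexive (trans (cong (N ^ r *_) (trans (𝔼-const n 0) (*-zeroʳ (N ^ n)))) (*-zeroʳ (N ^ r)))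
    𝔼-misses {n} r (T ∷ Ts) (r≤ ∷ r≤s) = begin
      N ^ r * 𝔼 (λ S → miss T S + misses Ts S)     ≡⟨ cong (N ^ r *_) (𝔼-+ (miss T) (misses Ts)) ⟩
      N ^ r * (𝔼 (miss T) + 𝔼 (misses Ts))         ≡⟨ *-distribˡ-+ (N ^ r) _ _ ⟩
      N ^ r * 𝔼 (miss T) + N ^ r * 𝔼 (misses Ts)   ≤⟨ +-mono-≤ (𝔼-miss r T r≤) (𝔼-misses r Ts r≤s) ⟩
      a ^ r * N ^ n + length Ts * (a ^ r * N ^ n)  ∎

    -- For x = `a` / `N`, the expected number of missed sets is at most k m x^(s+1), and
    -- `a ^ s * k ≤ N ^ s` says k x^s ≤ 1, leaving at most m x. The witness is a set that does no
    -- worse than average.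
    transversal-bound : .{{_ : NonZero N}} → ∀ {n} s k m (Ts : List (Subset n)) →
      All (λ T → suc s ≤ ∣ T ∣) Ts → length Ts ≡ k * m → a ^ s * k ≤ N ^ s →
      ∃[ S ] ((∣ S ∣ + misses Ts S) * N ≤ n * b + m * a)
    transversal-bound {n} s k m Ts large length≡ a^s*k≤ = S ,
      -- `N ^ n` is the scale of `𝔼`, and `N ^ s` is what remains of the denominator in `𝔼-misses`
      -- after one factor `N` is set aside.
      *-cancelʳ-≤ _ _ (N ^ n) {{m^n≢0 N n}} (*-cancelʳ-≤ _ _ (N ^ s) {{m^n≢0 N s}} (begin
        (∣ S ∣ + misses Ts S) * N * N ^ n * N ^ s
          ≡⟨ shuffle (∣ S ∣ + misses Ts S) N (N ^ n) (N ^ s) ⟩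
        N * N ^ s * (N ^ n * (∣ S ∣ + misses Ts S))
          ≤⟨ *-monoʳ-≤ (N * N ^ s) (≤-trans S≤ (≤-reflexive (𝔼-+ {n} ∣_∣ (misses Ts)))) ⟩
        N * N ^ s * (𝔼 {n} ∣_∣ + 𝔼 (misses Ts))
          ≡⟨ expand N (N ^ s) (𝔼 {n} ∣_∣) (𝔼 (misses Ts)) ⟩
        N ^ s * (N * 𝔼 {n} ∣_∣) + N * N ^ s * 𝔼 (misses Ts)
          ≤⟨ +-mono-≤ (≤-reflexive (cong (N ^ s *_) (𝔼-size n))) (𝔼-misses (suc s) Ts large) ⟩
        N ^ s * (n * b * N ^ n) + length Ts * (a * a ^ s * N ^ n)
          ≡⟨ cong (λ l → N ^ s * (n * b * N ^ n) + l * (a * a ^ s * N ^ n)) length≡ ⟩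
        N ^ s * (n * b * N ^ n) + k * m * (a * a ^ s * N ^ n)
          ≡⟨ cong (N ^ s * (n * b * N ^ n) +_) (isolate k m a (a ^ s) (N ^ n)) ⟩
        N ^ s * (n * b * N ^ n) + a ^ s * k * (m * a * N ^ n)
          ≤⟨ +-monoʳ-≤ (N ^ s * (n * b * N ^ n)) (*-monoˡ-≤ (m * a * N ^ n) a^s*k≤) ⟩
        N ^ s * (n * b * N ^ n) + N ^ s * (m * a * N ^ n)
          ≡⟨ collect (N ^ s) (n * b) (m * a) (N ^ n) ⟩
        (n * b + m * a) * N ^ n * N ^ s ∎))
      where
      S  = proj₁ (∃≤𝔼 (λ S → ∣ S ∣ + misses Ts S))
      S≤ = proj₂ (∃≤𝔼 (λ S → ∣ S ∣ + misses Ts S))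
      shuffle : ∀ x N y z → x * N * y * z ≡ N * z * (y * x)
      shuffle = solve-∀
      expand : ∀ N z e f → N * z * (e + f) ≡ z * (N * e) + N * z * f
      expand = solve-∀
      isolate : ∀ k m a x y → k * m * (a * x * y) ≡ x * k * (m * a * y)
      isolate = solve-∀
      collect : ∀ z x y w → z * (x * w) + z * (y * w) ≡ (x + y) * w * z
      collect = solve-∀

  -- Cliques of the factors, and the domination bound in natural numbers.

  module _ {n k m r : ℕ} (F : Fin k → Graph (Fin n))
           (iso : ∀ i → F i ≅ copies m (K r)) where

    private
      module F i = Graph (F i)
      module I i = _≅_ (iso i)
      module V i = Inverse (I.vertices i)

    label : Fin k → Fin n → Fin m
    label i v = proj₁ (V.to i v)

    block : Fin k → Fin m → Subset n
    block i j = Vec.tabulate λ v → does (label i v Fin.≟ j)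

    ∈-block⁺ : ∀ {i j v} → label i v ≡ j → v ∈ block i j
    ∈-block⁺ {i} {j} {v} eq = Vec.lookup⇒[]= v (block i j)
      (trans (Vec.lookup∘tabulate _ v) (dec-true (label i v Fin.≟ j) eq))

    ∈-block⁻ : ∀ {i j v} → v ∈ block i j → label i v ≡ j
    ∈-block⁻ {i} {j} {v} v∈
      with label i v Fin.≟ j | trans (sym (Vec.lookup∘tabulate (λ v → does (label i v Fin.≟ j)) v)) (Vec.[]=⇒lookup v∈)
    ... | yes eq | _  = eq
    ... | no _   | ()

    vertex∈block : ∀ i j q → V.from i (j , q) ∈ block i j
    vertex∈block i j q = ∈-block⁺ (cong proj₁ (V.strictlyInverseˡ i (j , q)))

    r≤∣block∣ : ∀ i j → r ≤ ∣ block i j ∣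
    r≤∣block∣ i j = injection⇒≤∣p∣ (block i j) (λ q → V.from i (j , q)) inj (vertex∈block i j)
      where
      inj : Injective _≡_ _≡_ (λ q → V.from i (j , q))
      inj {p} {q} eq = cong proj₂ (trans (sym (V.strictlyInverseˡ i (j , p)))
        (trans (cong (V.to i) eq) (V.strictlyInverseˡ i (j , q))))

    same-label⇒adjacent : ∀ i {u v} → label i u ≡ label i v → u ≢ v → F._~_ i u v
    same-label⇒adjacent i {u} {v} eq u≢v = Equivalence.from (I.edges i u v)
      (eq , λ eq₂ → u≢v (trans (sym (V.strictlyInverseʳ i u))
        (trans (cong (V.from i) (cong₂ _,_ eq eq₂)) (V.strictlyInverseʳ i v))))

    -- Indexing by `Fin (k * m)` gives the length `k * m` at once; `combine` locates a given block.
    blocks : List (Subset n)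
    blocks = tabulate λ p → uncurry block (remQuot {k} m p)

    block∈blocks : ∀ i j → block i j ∈ᴸ blocks
    block∈blocks i j = subst (_∈ᴸ blocks) (cong (uncurry block) (Fin.remQuot-combine i j))
      (∈-tabulate⁺ (combine i j))

    -- The block of `v` in `F i` is a clique and contains some `u` of `D`; as `v` is not in `D`, it
    -- differs from `u` and is adjacent to it.
    meets-blocks⇒dominating : ∀ {D} → All (λ T → Meets T D) blocks → SimultaneouslyDominating F D
    meets-blocks⇒dominating meets i v v∉D
      with u , u∈T , u∈D ← All.lookup meets (block∈blocks i (label i v))
      = u , u∈D , same-label⇒adjacent i (sym (∈-block⁻ u∈T)) λ { refl → v∉D u∈D }

    γsd≤ : .{{_ : NonZero r}} → ∀ S → γsd F ≤ ∣ S ∣ + misses blocks S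
    γsd≤ S =
      let q = fromℕ< (>-nonZero⁻¹ r)
          -- Blocks are nonempty because `r` is nonzero: `q` is index 0 in a clique.
          D , _ , meets , ∣D∣≤ = extend-to-transversal S {blocks} (All.tabulate⁺ λ p →
            let i , j = remQuot {k} m p in V.from i (j , q) , vertex∈block i j q)
      in ≤-trans (proj₂ (proj₂ (minimumDominatingSize F)) (D , meets-blocks⇒dominating meets , refl))
                 ∣D∣≤

  -- For `m` = n / r and x = `a` / (`a + b`), this reads γsd ≤ (1 - x) n + (n / r) x, cleared of
  -- denominators.
  γsd-bound : ∀ {n k m s} (F : Fin k → Graph (Fin n)) → (∀ i → F i ≅ copies m (K (suc s))) →
    ∀ a b → .{{_ : NonZero (a + b)}} → a ^ s * k ≤ (a + b) ^ s →
    γsd F * (a + b) ≤ n * b + m * a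
  γsd-bound {k = k} {m} {s} F iso a b a^s*k≤
    with S , S≤ ← transversal-bound a b s k m (blocks F iso)
           (All.tabulate⁺ λ p → uncurry (r≤∣block∣ F iso) (remQuot {k} m p))
           (length-tabulate {n = k * m} _) a^s*k≤
    = ≤-trans (*-monoˡ-≤ (a + b) (γsd≤ F iso S)) S≤

module RationalBounds where

  open import Data.Nat.Base as ℕ using (ℕ; zero; suc; NonZero)
  import Data.Nat.Properties as ℕ
  open import Data.Nat.Tactic.RingSolver using (solve-∀)
  open import Data.Integer.Base as ℤ using (+_)
  import Data.Integer.Properties as ℤ
  open import Data.Rational.Base hiding (NonZero)
  open import Data.Rational.Properties
  open import Data.Rational.Solver using (module +-*-Solver)
  open import Data.Rational.Unnormalised.Base as ℚᵘ using (mkℚᵘ; *≡*; *≤*)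
  import Data.Rational.Unnormalised.Properties as ℚᵘ
  open import Data.Product.Base using (_,_)
  open import Data.Sum.Base using (inj₁; inj₂)
  open import Algebra.Bundles using (module CommutativeRing)
  open import Algebra.Properties.CommutativeSemiring.Exp
    (CommutativeRing.commutativeSemiring +-*-commutativeRing) using (_^_; ^-distrib-*)
  open import Relation.Nullary using (contradiction)
  open import Relation.Binary.PropositionalEquality

  open import Data.Fin.Base using (Fin)
  open Domination using (γsd-bound)

  open ≤-Reasoning
  open +-*-Solver using (solve; con; _:=_; _:+_; _:*_; _:-_)

  -- Arithmetic and order of rationals, and the embedding of ℕ.

  infix 8 ⟦_⟧

  ⟦_⟧ : ℕ → ℚ
  ⟦ n ⟧ = + n / 1

  /-* : ∀ a b m n → (+ a / suc m) * (+ b / suc n) ≡ + (a ℕ.* b) / (suc m ℕ.* suc n)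
  /-* a b m n = toℚᵘ-injective
    (ℚᵘ.≃-trans (toℚᵘ-homo-* (+ a / suc m) (+ b / suc n))
    (ℚᵘ.≃-trans (ℚᵘ.*-cong (toℚᵘ-fromℚᵘ (mkℚᵘ (+ a) m)) (toℚᵘ-fromℚᵘ (mkℚᵘ (+ b) n)))
    (ℚᵘ.≃-trans (*≡* (cong (ℤ._* + (suc m ℕ.* suc n)) (sym (ℤ.pos-* a b))))
      -- `mkℚᵘ` takes the denominator minus one, here the predecessor of `suc m * suc n`.
      (ℚᵘ.≃-sym (toℚᵘ-fromℚᵘ (mkℚᵘ (+ (a ℕ.* b)) (n ℕ.+ m ℕ.* suc n)))))))

  /-≡ : ∀ a b m n → a ℕ.* suc n ≡ b ℕ.* suc m → + a / suc m ≡ + b / suc n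
  /-≡ a b m n eq = ≤-antisym (/-mono-≤ a b m n (ℕ.≤-reflexive eq))
                             (/-mono-≤ b a n m (ℕ.≤-reflexive (sym eq)))

  /-*-cancel : ∀ a m → (+ a / suc m) * ⟦ suc m ⟧ ≡ ⟦ a ⟧
  /-*-cancel a m = trans (/-* a (suc m) m 0)
    (/-≡ (a ℕ.* suc m) a (0 ℕ.+ m ℕ.* 1) 0 (eq a m))
    where
    eq : ∀ a m → a ℕ.* (1 ℕ.+ m) ℕ.* 1 ≡ a ℕ.* (1 ℕ.+ (0 ℕ.+ m ℕ.* 1))
    eq = solve-∀

  ⟦⟧-* : ∀ a b → ⟦ a ⟧ * ⟦ b ⟧ ≡ ⟦ a ℕ.* b ⟧
  ⟦⟧-* a b = /-* a b 0 0

  ⟦⟧-suc : ∀ a → 1ℚ + ⟦ a ⟧ ≡ ⟦ suc a ⟧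
  ⟦⟧-suc a = trans (+-comm 1ℚ ⟦ a ⟧) (/-+ a 0)

  ⟦⟧-+ : ∀ a b → ⟦ a ⟧ + ⟦ b ⟧ ≡ ⟦ a ℕ.+ b ⟧
  ⟦⟧-+ zero    b = +-identityˡ ⟦ b ⟧
  ⟦⟧-+ (suc a) b = begin-equality
    ⟦ suc a ⟧ + ⟦ b ⟧      ≡⟨ cong (_+ ⟦ b ⟧) (⟦⟧-suc a) ⟨
    1ℚ + ⟦ a ⟧ + ⟦ b ⟧     ≡⟨ +-assoc 1ℚ ⟦ a ⟧ ⟦ b ⟧ ⟩
    1ℚ + (⟦ a ⟧ + ⟦ b ⟧)   ≡⟨ cong (λ z → 1ℚ + z) (⟦⟧-+ a b) ⟩
    1ℚ + ⟦ a ℕ.+ b ⟧       ≡⟨ ⟦⟧-suc (a ℕ.+ b) ⟩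
    ⟦ suc (a ℕ.+ b) ⟧      ∎

  ⟦⟧-^ : ∀ a n → ⟦ a ⟧ ^ n ≡ ⟦ a ℕ.^ n ⟧
  ⟦⟧-^ a zero    = refl
  ⟦⟧-^ a (suc n) = trans (cong (⟦ a ⟧ *_) (⟦⟧-^ a n)) (⟦⟧-* a (a ℕ.^ n))

  ⟦⟧-mono-≤ : ∀ {a b} → a ℕ.≤ b → ⟦ a ⟧ ≤ ⟦ b ⟧
  ⟦⟧-mono-≤ {a} {b} a≤b = /-mono-≤ a b 0 0 (ℕ.*-monoˡ-≤ 1 a≤b)

  ⟦⟧-cancel-≤ : ∀ {a b} → ⟦ a ⟧ ≤ ⟦ b ⟧ → a ℕ.≤ b
  ⟦⟧-cancel-≤ {a} {b} a≤b
    with *≤* h ← ℚᵘ.≤-respˡ-≃ (toℚᵘ-fromℚᵘ (mkℚᵘ (+ a) 0))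
                (ℚᵘ.≤-respʳ-≃ (toℚᵘ-fromℚᵘ (mkℚᵘ (+ b) 0)) (toℚᵘ-mono-≤ a≤b))
    = ℤ.drop‿+≤+ (subst₂ ℤ._≤_ (ℤ.*-identityʳ (+ a)) (ℤ.*-identityʳ (+ b)) h)

  ⟦⟧-nonNeg : ∀ n → NonNegative ⟦ n ⟧
  ⟦⟧-nonNeg n = nonNegative (⟦⟧-mono-≤ {0} {n} ℕ.z≤n)

  ⟦⟧-pos : ∀ n → Positive ⟦ suc n ⟧
  ⟦⟧-pos n = positive (<-≤-trans (positive⁻¹ 1ℚ) (⟦⟧-mono-≤ {1} {suc n} (ℕ.s≤s ℕ.z≤n)))

  0≤* : ∀ {p q} → 0ℚ ≤ p → 0ℚ ≤ q → 0ℚ ≤ p * q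
  0≤* {p} {q} 0≤p 0≤q = nonNegative⁻¹ (p * q)
    {{nonNeg*nonNeg⇒nonNeg p {{nonNegative 0≤p}} q {{nonNegative 0≤q}}}}

  *-mono-≤ : ∀ {p q r s} → 0ℚ ≤ q → 0ℚ ≤ r → p ≤ q → r ≤ s → p * r ≤ q * s
  *-mono-≤ {q = q} {r} 0≤q 0≤r p≤q r≤s = ≤-trans
    (*-monoʳ-≤-nonNeg r {{nonNegative 0≤r}} p≤q) (*-monoˡ-≤-nonNeg q {{nonNegative 0≤q}} r≤s)

  0≤^ : ∀ {p} n → 0ℚ ≤ p → 0ℚ ≤ p ^ n
  0≤^ zero    0≤p = nonNegative⁻¹ 1ℚ
  0≤^ (suc n) 0≤p = 0≤* 0≤p (0≤^ n 0≤p)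

  ^-pos : ∀ p n → .{{Positive p}} → Positive (p ^ n)
  ^-pos p zero    = _
  ^-pos p (suc n) = pos*pos⇒pos p (p ^ n) {{^-pos p n}}

  ^-monoˡ-≤ : ∀ {p q} n → 0ℚ ≤ p → p ≤ q → p ^ n ≤ q ^ n
  ^-monoˡ-≤ zero    0≤p p≤q = ≤-refl
  ^-monoˡ-≤ (suc n) 0≤p p≤q =
    *-mono-≤ (≤-trans 0≤p p≤q) (0≤^ n 0≤p) p≤q (^-monoˡ-≤ n 0≤p p≤q)

  p≤p+q : ∀ p {q} → 0ℚ ≤ q → p ≤ p + q
  p≤p+q p {q} 0≤q = subst (_≤ p + q) (+-identityʳ p) (+-monoʳ-≤ p 0≤q)

  -- Bernoulli's inequality and upper sums of the logarithm.

  -- This is (1 + u / y)^σ ≥ 1 + σ u / y for σ = s + 1, multiplied by y^σ so that y = 0 is allowed.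
  bernoulli : ∀ {y u} s → 0ℚ ≤ y → 0ℚ ≤ u → y ^ s * (y + ⟦ suc s ⟧ * u) ≤ (y + u) ^ suc s
  bernoulli {y} {u} zero    0≤y 0≤u = ≤-reflexive (eq y u)
    where
    eq : ∀ y u → 1ℚ * (y + 1ℚ * u) ≡ (y + u) * 1ℚ
    eq = solve 2 (λ y u → con 1ℚ :* (y :+ con 1ℚ :* u) := (y :+ u) :* con 1ℚ) refl
  bernoulli {y} {u} (suc s) 0≤y 0≤u = begin
    y * y ^ s * (y + ⟦ 2 ℕ.+ s ⟧ * u)
      ≡⟨ cong (λ z → y * y ^ s * (y + z * u)) (⟦⟧-suc (suc s)) ⟨
    y * y ^ s * (y + (1ℚ + c) * u)
      -- The added term is the excess of (y + u)(y + c u) over y (y + (1 + c) u), times `y ^ s`.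
      ≤⟨ p≤p+q _ (0≤* (0≤^ s 0≤y) (0≤* (0≤* (nonNegative⁻¹ c {{⟦⟧-nonNeg (suc s)}}) 0≤u) 0≤u)) ⟩
    y * y ^ s * (y + (1ℚ + c) * u) + y ^ s * (c * u * u)
      ≡⟨ eq y u c (y ^ s) ⟩
    (y + u) * (y ^ s * (y + c * u))
      ≤⟨ *-monoˡ-≤-nonNeg (y + u) {{nonNegative (+-mono-≤ 0≤y 0≤u)}} (bernoulli s 0≤y 0≤u) ⟩
    (y + u) * (y + u) ^ suc s ∎
    where
    c = ⟦ suc s ⟧
    eq : ∀ y u c z → y * z * (y + (1ℚ + c) * u) + z * (c * u * u) ≡ (y + u) * (z * (y + c * u))
    eq = solve 4 (λ y u c z → y :* z :* (y :+ (con 1ℚ :+ c) :* u) :+ z :* (c :* u :* u)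
                            := (y :+ u) :* (z :* (y :+ c :* u))) refl

  -- As long as y ≤ σ = s + 1, also y u ≤ σ u, so by Bernoulli raising y by u gains at least a
  -- factor 1 + u in y^σ.
  [1+u]*y^s≤[y+u]^s : ∀ {y u} s → 0ℚ ≤ y → 0ℚ ≤ u → y ≤ ⟦ suc s ⟧ → y ^ suc s * (1ℚ + u) ≤ (y + u) ^ suc s
  [1+u]*y^s≤[y+u]^s {y} {u} s 0≤y 0≤u y≤s = begin
    y * y ^ s * (1ℚ + u)              ≡⟨ eq y u (y ^ s) ⟩
    y ^ s * (y + y * u)               ≤⟨ *-monoˡ-≤-nonNeg (y ^ s) {{nonNegative (0≤^ s 0≤y)}}
                                          (+-monoʳ-≤ y (*-monoʳ-≤-nonNeg u {{nonNegative 0≤u}} y≤s)) ⟩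
    y ^ s * (y + ⟦ suc s ⟧ * u)       ≤⟨ bernoulli s 0≤y 0≤u ⟩
    (y + u) ^ suc s                   ∎
    where
    eq : ∀ y u z → y * z * (1ℚ + u) ≡ z * (y + y * u)
    eq = solve 3 (λ y u z → y :* z :* (con 1ℚ :+ u) := z :* (y :+ y :* u)) refl

  0≤sum< : ∀ t {f : ℕ → ℚ} → (∀ i → 0ℚ ≤ f i) → 0ℚ ≤ sum< t f
  0≤sum< zero    0≤f = ≤-refl
  0≤sum< (suc t) 0≤f = +-mono-≤ (0≤sum< t 0≤f) (0≤f t)

  -- For σ = s + 1 and the sum H of 1 / j over [M + 1 , M + t], this is the bound
  -- (M + t + 1) / (M + 1) ≤ (σ / (σ − H))^σ; the factors of the telescoping
  -- product on the left are absorbed one at a time.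
  harmonic-power : ∀ M s t {y} → 0ℚ ≤ y → y + sum< t (λ i → 1/suc (M ℕ.+ i)) ≤ ⟦ suc s ⟧ →
    y ^ suc s * ⟦ suc (M ℕ.+ t) ⟧ ≤ ⟦ suc s ⟧ ^ suc s * ⟦ suc M ⟧
  harmonic-power M s zero {y} 0≤y y≤ rewrite ℕ.+-identityʳ M | +-identityʳ y =
    *-monoʳ-≤-nonNeg ⟦ suc M ⟧ {{⟦⟧-nonNeg (suc M)}} (^-monoˡ-≤ (suc s) 0≤y y≤)
  harmonic-power M s (suc t) {y} 0≤y y≤ = begin
    y ^ suc s * ⟦ suc (M ℕ.+ suc t) ⟧   ≡⟨ cong (y ^ suc s *_) factor ⟩
    y ^ suc s * ((1ℚ + u) * P)          ≡⟨ *-assoc (y ^ suc s) (1ℚ + u) P ⟨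
    y ^ suc s * (1ℚ + u) * P            ≤⟨ *-monoʳ-≤-nonNeg P {{⟦⟧-nonNeg (suc (M ℕ.+ t))}}
                                            ([1+u]*y^s≤[y+u]^s s 0≤y 0≤u y≤s) ⟩
    -- The last summand `u` moves from the sum into `y`, which is why `y` varies in the induction.
    (y + u) ^ suc s * P                 ≤⟨ harmonic-power M s t (+-mono-≤ 0≤y 0≤u)
                                            (subst (_≤ ⟦ suc s ⟧) (regroup y σ u) y≤) ⟩
    ⟦ suc s ⟧ ^ suc s * ⟦ suc M ⟧       ∎
    where
    u = 1/suc (M ℕ.+ t)
    P = ⟦ suc (M ℕ.+ t) ⟧
    σ = sum< t (λ i → 1/suc (M ℕ.+ i))
    0≤u : 0ℚ ≤ u
    0≤u = 0≤1/suc (M ℕ.+ t)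
    y≤s : y ≤ ⟦ suc s ⟧
    y≤s = ≤-trans (p≤p+q y (+-mono-≤ (0≤sum< t λ i → 0≤1/suc (M ℕ.+ i)) 0≤u)) y≤
    regroup : ∀ a b c → a + (b + c) ≡ (a + c) + b
    regroup = solve 3 (λ a b c → a :+ (b :+ c) := (a :+ c) :+ b) refl
    factor : ⟦ suc (M ℕ.+ suc t) ⟧ ≡ (1ℚ + u) * P
    factor = begin-equality
      ⟦ suc (M ℕ.+ suc t) ⟧    ≡⟨ cong (λ z → ⟦ suc z ⟧) (ℕ.+-suc M t) ⟩
      ⟦ suc (suc (M ℕ.+ t)) ⟧  ≡⟨ ⟦⟧-suc (suc (M ℕ.+ t)) ⟨
      1ℚ + P                   ≡⟨ +-comm 1ℚ P ⟩
      P + 1ℚ                   ≡⟨ cong₂ _+_ (*-identityˡ P) (/-*-cancel 1 (M ℕ.+ t)) ⟨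
      1ℚ * P + u * P           ≡⟨ *-distribʳ-+ P 1ℚ u ⟨
      (1ℚ + u) * P             ∎

  -- The hypothesis puts x = `b` / `suc N` above the σ-th root of 1 / (k + 1), σ = s + 1. If σ x + H
  -- < σ for the upper sum H, then `harmonic-power` at y = σ x would give x^σ (k + 1) ≤ 1.
  upperSum-bound : ∀ k s N b → suc N ℕ.^ suc s ℕ.< b ℕ.^ suc s ℕ.* suc k →
    ⟦ suc s ⟧ ≤ ⟦ suc s ⟧ * (+ b / suc N) + upperSum (suc k) N
  upperSum-bound k s N b lt with 2 ℕ.^ N | 2^-suc N
  ... | _ | M , refl with ≤-total ⟦ suc s ⟧ (⟦ suc s ⟧ * (+ b / suc N) + sum< (k ℕ.* suc M) λ i → 1/suc (M ℕ.+ i))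
  ...   | inj₁ le = le
  ...   | inj₂ ge = contradiction lt (ℕ.≤⇒≯ (⟦⟧-cancel-≤ (begin
    ⟦ b ℕ.^ suc s ℕ.* suc k ⟧            ≡⟨ ⟦⟧-* (b ℕ.^ suc s) (suc k) ⟨
    ⟦ b ℕ.^ suc s ⟧ * ⟦ suc k ⟧          ≡⟨ cong (_* ⟦ suc k ⟧) (⟦⟧-^ b (suc s)) ⟨
    ⟦ b ⟧ ^ suc s * ⟦ suc k ⟧            ≡⟨ cong (λ z → z ^ suc s * ⟦ suc k ⟧) (/-*-cancel b N) ⟨
    (x * D) ^ suc s * ⟦ suc k ⟧          ≡⟨ cong (_* ⟦ suc k ⟧) (^-distrib-* x D (suc s)) ⟩
    x ^ suc s * D ^ suc s * ⟦ suc k ⟧    ≡⟨ swap (x ^ suc s) (D ^ suc s) ⟦ suc k ⟧ ⟩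
    x ^ suc s * ⟦ suc k ⟧ * D ^ suc s    ≤⟨ *-monoʳ-≤-nonNeg (D ^ suc s)
                                             {{nonNegative (0≤^ (suc s) 0≤D)}} x^s*k≤1 ⟩
    1ℚ * D ^ suc s                       ≡⟨ *-identityˡ (D ^ suc s) ⟩
    D ^ suc s                            ≡⟨ ⟦⟧-^ (suc N) (suc s) ⟩
    ⟦ suc N ℕ.^ suc s ⟧                  ∎)))
    where
    x = + b / suc N
    D = ⟦ suc N ⟧
    S = ⟦ suc s ⟧
    0≤D : 0ℚ ≤ D
    0≤D = nonNegative⁻¹ D {{⟦⟧-nonNeg (suc N)}}
    0≤Sx : 0ℚ ≤ S * x
    0≤Sx = 0≤* (nonNegative⁻¹ S {{⟦⟧-nonNeg (suc s)}}) (/-mono-≤ 0 b 0 N ℕ.z≤n)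
    swap : ∀ a b c → a * b * c ≡ a * c * b
    swap = solve 3 (λ a b c → a :* b :* c := a :* c :* b) refl
    regroup : ∀ a b c d → a * b * (c * d) ≡ a * (b * c * d)
    regroup = solve 4 (λ a b c d → a :* b :* (c :* d) := a :* (b :* c :* d)) refl
    x^s*k≤1 : x ^ suc s * ⟦ suc k ⟧ ≤ 1ℚ
    x^s*k≤1 = *-cancelʳ-≤-pos ⟦ suc M ⟧ {{⟦⟧-pos M}} (*-cancelˡ-≤-pos (S ^ suc s)
      {{^-pos S (suc s) {{⟦⟧-pos s}}}} (begin
        S ^ suc s * (x ^ suc s * ⟦ suc k ⟧ * ⟦ suc M ⟧)
          ≡⟨ regroup (S ^ suc s) (x ^ suc s) ⟦ suc k ⟧ ⟦ suc M ⟧ ⟨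
        S ^ suc s * x ^ suc s * (⟦ suc k ⟧ * ⟦ suc M ⟧)
          -- With `suc M` = 2^N, the telescoping product ends at `suc k * suc M`, which unfolds to
          -- `suc (M + k * suc M)`; its value is therefore k + 1.
          ≡⟨ cong₂ _*_ (sym (^-distrib-* S x (suc s))) (⟦⟧-* (suc k) (suc M)) ⟩
        (S * x) ^ suc s * ⟦ suc (M ℕ.+ k ℕ.* suc M) ⟧
          ≤⟨ harmonic-power M s (k ℕ.* suc M) 0≤Sx ge ⟩
        S ^ suc s * ⟦ suc M ⟧
          ≡⟨ cong (S ^ suc s *_) (*-identityˡ ⟦ suc M ⟧) ⟨
        S ^ suc s * (1ℚ * ⟦ suc M ⟧) ∎))

  -- Both inequalities at a single approximation of the root.

  module _ {s ρ n : ℚ} ([1+s]ρ≡1 : (1ℚ + s) * ρ ≡ 1ℚ) where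

    -- Here `s` is r - 1 and `ρ` is 1 / r. The left side is n ρ (s + 1 - s x); the errors `e` in the
    -- root and in the logarithm have weights `s` and 1, so together they cost n ρ (1 + s) e = n e.
    bound-≤ : ∀ {x L e} → 0ℚ ≤ n → 0ℚ ≤ ρ → s ≤ s * (x + e) + (L + e) →
              (1ℚ - s * ρ * x) * n ≤ n * (L + 1ℚ) * ρ + n * e
    bound-≤ {x} {L} {e} 0≤n 0≤ρ s≤ = begin
      (1ℚ - s * ρ * x) * n
        ≡⟨ cong (λ z → (z - s * ρ * x) * n) [1+s]ρ≡1 ⟨
      ((1ℚ + s) * ρ - s * ρ * x) * n
        ≡⟨ solve 4 (λ s ρ x n → ((con 1ℚ :+ s) :* ρ :- s :* ρ :* x) :* n
                             := n :* ρ :* (s :+ (con 1ℚ :- s :* x))) refl s ρ x n ⟩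
      n * ρ * (s + (1ℚ - s * x))
        ≤⟨ *-monoˡ-≤-nonNeg (n * ρ) {{nonNegative (0≤* 0≤n 0≤ρ)}} (+-monoˡ-≤ (1ℚ - s * x) s≤) ⟩
      n * ρ * (s * (x + e) + (L + e) + (1ℚ - s * x))
        ≡⟨ solve 6 (λ s ρ x n L e → n :* ρ :* (s :* (x :+ e) :+ (L :+ e) :+ (con 1ℚ :- s :* x))
                             := n :* (L :+ con 1ℚ) :* ρ :+ n :* e :* ((con 1ℚ :+ s) :* ρ)) refl s ρ x n L e ⟩
      n * (L + 1ℚ) * ρ + n * e * ((1ℚ + s) * ρ)
        ≡⟨ cong (λ z → n * (L + 1ℚ) * ρ + n * e * z) [1+s]ρ≡1 ⟩
      n * (L + 1ℚ) * ρ + n * e * 1ℚ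
        ≡⟨ cong (λ z → n * (L + 1ℚ) * ρ + z) (*-identityʳ (n * e)) ⟩
      n * (L + 1ℚ) * ρ + n * e ∎

    -- Dividing by `N` gives n (1 - x) + n ρ x, and 1 - ρ = s ρ.
    ≤-bound : ∀ {γ m a b N x} → .{{Positive N}} → m ≡ n * ρ → x * N ≡ a → a + b ≡ N →
              γ * N ≤ n * b + m * a → γ ≤ (1ℚ - s * ρ * x) * n
    ≤-bound {γ} {_} {_} {b} {N} {x} refl refl a+b≡N γN≤ = *-cancelʳ-≤-pos N (begin
      γ * N
        ≤⟨ γN≤ ⟩
      n * b + n * ρ * (x * N)
        ≡⟨ solve 6 (λ s ρ x n b N → n :* b :+ n :* ρ :* (x :* N)
             := n :* b :+ n :* (x :* N) :* ((con 1ℚ :+ s) :* ρ) :- s :* ρ :* x :* n :* N) refl s ρ x n b N ⟩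
      n * b + n * (x * N) * ((1ℚ + s) * ρ) - s * ρ * x * n * N
        ≡⟨ cong (λ z → n * b + n * (x * N) * z - s * ρ * x * n * N) [1+s]ρ≡1 ⟩
      n * b + n * (x * N) * 1ℚ - s * ρ * x * n * N
        ≡⟨ solve 6 (λ s ρ x n b N → n :* b :+ n :* (x :* N) :* con 1ℚ :- s :* ρ :* x :* n :* N
             := n :* (x :* N :+ b) :- s :* ρ :* x :* n :* N) refl s ρ x n b N ⟩
      n * (x * N + b) - s * ρ * x * n * N
        ≡⟨ cong (λ z → n * z - s * ρ * x * n * N) a+b≡N ⟩
      n * N - s * ρ * x * n * N
        ≡⟨ solve 5 (λ s ρ x n N → n :* N :- s :* ρ :* x :* n :* N
             := (con 1ℚ :- s :* ρ :* x) :* n :* N) refl s ρ x n N ⟩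
      (1ℚ - s * ρ * x) * n * N ∎)

  module _ (s : ℕ) where

    private
      ρ = + 1 / suc (suc s)
      S = ⟦ suc s ⟧

    [1+s]/[1+s]≡1 : (1ℚ + S) * ρ ≡ 1ℚ
    [1+s]/[1+s]≡1 = trans (cong (_* ρ) (⟦⟧-suc (suc s)))
      (trans (*-comm ⟦ suc (suc s) ⟧ ρ) (/-*-cancel 1 (suc s)))

    module _ (n k i : ℕ) where

      open Root 1 (suc k) (suc s)

      private bound = (1ℚ - S * ρ * approx i) * ⟦ n ⟧

      -- The weights are `numer i` and its complement in `suc i`, so that the probability of
      -- omitting a vertex is exactly `approx i`.
      γsd≤bound : ∀ {m} (F : Fin (suc k) → Graph (Fin n)) → (∀ j → F j ≅ copies m (K (suc (suc s)))) →
                  m ℕ.* suc (suc s) ≡ n → ⟦ γsd F ⟧ ≤ bound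
      γsd≤bound {m} F iso mr≡n = ≤-bound {S} {ρ} {⟦ n ⟧} [1+s]/[1+s]≡1 {x = approx i} {{⟦⟧-pos i}}
        m≡nρ
        (/-*-cancel a i) (trans (⟦⟧-+ a b) (cong ⟦_⟧ a+b≡N))
        (subst₂ _≤_ (sym (⟦⟧-* (γsd F) (suc i)))
                    (trans (sym (⟦⟧-+ (n ℕ.* b) (m ℕ.* a)))
                           (sym (cong₂ _+_ (⟦⟧-* n b) (⟦⟧-* m a))))
          (⟦⟧-mono-≤ (subst (λ N → γsd F ℕ.* N ℕ.≤ n ℕ.* b ℕ.+ m ℕ.* a) a+b≡N
            (γsd-bound F iso a b {{subst NonZero (sym a+b≡N) _}}
              (subst (λ N → a ℕ.^ suc s ℕ.* suc k ℕ.≤ N ℕ.^ suc s) (sym a+b≡N) a^s*k≤N^s)))))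
        where
        a = numer i
        b = suc i ℕ.∸ a
        a^s*k≤N^s : a ℕ.^ suc s ℕ.* suc k ℕ.≤ suc i ℕ.^ suc s
        -- `2 * suc i` is the search limit in `numer` for the numerator 1.
        a^s*k≤N^s = ℕ.≤-trans (greatest-holds (below? i) (2 ℕ.* suc i) (below-0 i))
                              (ℕ.≤-reflexive (ℕ.*-identityˡ (suc i ℕ.^ suc s)))
        a≤N : a ℕ.≤ suc i
        -- The root of 1 / (k + 1) is at most 1, so the truncated subtraction in `b` is exact.
        a≤N = ℕ.≮⇒≥ λ N<a → ℕ.<⇒≱ (ℕ.^-monoˡ-< (suc s) N<a)
          (ℕ.≤-trans (ℕ.m≤m*n (a ℕ.^ suc s) (suc k)) a^s*k≤N^s)
        a+b≡N : a ℕ.+ b ≡ suc i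
        a+b≡N = ℕ.m+[n∸m]≡n a≤N
        m≡nρ : ⟦ m ⟧ ≡ ⟦ n ⟧ * ρ
        m≡nρ = begin-equality
          ⟦ m ⟧                          ≡⟨ *-identityʳ ⟦ m ⟧ ⟨
          ⟦ m ⟧ * 1ℚ                     ≡⟨ cong (⟦ m ⟧ *_) (/-*-cancel 1 (suc s)) ⟨
          ⟦ m ⟧ * (ρ * ⟦ suc (suc s) ⟧)  ≡⟨ swap ⟦ m ⟧ ρ ⟦ suc (suc s) ⟧ ⟩
          ⟦ m ⟧ * ⟦ suc (suc s) ⟧ * ρ    ≡⟨ cong (_* ρ) (⟦⟧-* m (suc (suc s))) ⟩
          ⟦ m ℕ.* suc (suc s) ⟧ * ρ      ≡⟨ cong (λ z → ⟦ z ⟧ * ρ) mr≡n ⟩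
          ⟦ n ⟧ * ρ                      ∎
          where
          swap : ∀ x y z → x * (y * z) ≡ x * z * y
          swap = solve 3 (λ x y z → x :* (y :* z) := x :* z :* y) refl

      -- With e = `1/suc i`, maximality of `numer i` puts `approx i` + e above the root, and `gap`
      -- replaces the upper sum by the lower sum plus e.
      bound≤ln : bound ≤ ⟦ n ⟧ * (lowerSum (suc k) i + 1ℚ) * ρ + ⟦ n ⟧ * 1/suc i
      bound≤ln = bound-≤ {S} {ρ} {⟦ n ⟧} [1+s]/[1+s]≡1 {L = lowerSum (suc k) i}
         (nonNegative⁻¹ ⟦ n ⟧ {{⟦⟧-nonNeg n}}) (0≤1/suc (suc s))
        (begin
        S
          ≤⟨ upperSum-bound k s i (suc (numer i)) (subst (ℕ._< suc (numer i) ℕ.^ suc s ℕ.* suc k)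
               (ℕ.*-identityˡ (suc i ℕ.^ suc s))
               (ℕ.≰⇒> (greatest-fails (below? i) (2 ℕ.* suc i) (¬below-bound i)))) ⟩
        S * (+ suc (numer i) / suc i) + upperSum (suc k) i
          ≡⟨ cong (λ z → S * z + upperSum (suc k) i) (/-+ (numer i) i) ⟨
        S * (approx i + 1/suc i) + upperSum (suc k) i
          ≤⟨ +-monoʳ-≤ (S * (approx i + 1/suc i)) (gap (suc k) i) ⟩
        S * (approx i + 1/suc i) + (lowerSum (suc k) i + 1/suc i) ∎)

  -- From termwise inequalities to real numbers.

  ≤⇒≤ᴿ : ∀ {x y} → (∀ i → seq x i ≤ seq y i) → x ≤ᴿ y
  ≤⇒≤ᴿ x≤y ε 0<ε = 0 , λ {i} _ → ≤-trans (x≤y i) (p≤p+q _ (<⇒≤ 0<ε))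

  ≤+c/n⇒≤ᴿ : ∀ {x y c} → 0ℚ < c → (∀ i → seq x i ≤ seq y i + c * 1/suc i) → x ≤ᴿ y
  ≤+c/n⇒≤ᴿ {x} {y} {c} 0<c x≤y ε 0<ε =
    let δ , 0<δ , cδ≡ε = quotient-pos 0<c 0<ε
        N , 1/N≤δ = archimedean δ 0<δ
    in N , λ {i} N≤i → begin
      seq x i                ≤⟨ x≤y i ⟩
      seq y i + c * 1/suc i  ≤⟨ +-monoʳ-≤ (seq y i) (*-monoˡ-≤-nonNeg c {{nonNegative (<⇒≤ 0<c)}}
                                  (≤-trans (1/suc-anti N≤i) 1/N≤δ)) ⟩
      seq y i + c * δ        ≡⟨ cong (λ z → seq y i + z) cδ≡ε ⟩
      seq y i + ε            ∎

open import Data.Nat.Base using (ℕ; suc; NonZero; _∸_; _/_; _≤_; s≤s)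
open import Data.Nat.Divisibility using (_∣_)
open import Data.Nat.DivMod using (m/n*n≡m)
open import Data.Fin.Base using (Fin)
open import Data.Product.Base using (_×_; _,_)
open import Data.Rational.Properties using (positive⁻¹)
open RationalBounds

theorem13 : ∀ (r n k : ℕ) .{{_ : NonZero r}} .{{_ : NonZero (r ∸ 1)}} .{{_ : NonZero k}} →
    2 ≤ r → r ≤ n → r ∣ n → 2 ≤ k →
    (F : Fin k → Graph (Fin n)) →
    (∀ i → F i ≅ copies (n / r) (K r)) →
    let bound = (fromℕ 1 -ᴿ (fromℕ (r ∸ 1) /ᴿ r) *ᴿ (⟨ 1 / k ⟩^1/ (r ∸ 1))) *ᴿ fromℕ n
    in (fromℕ (γsd F) ≤ᴿ bound) × (bound ≤ᴿ (fromℕ n *ᴿ (ln k +ᴿ fromℕ 1)) /ᴿ r)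
theorem13 (suc (suc s)) (suc n) (suc k) (s≤s (s≤s _)) _ r∣n _ F iso =
  -- Real operations act termwise, so the `i`-th terms unfold to the rational expressions of the
  -- lemmas.
  ≤⇒≤ᴿ {x} {bound} (λ i → γsd≤bound s (suc n) k i F iso (m/n*n≡m r∣n)) ,
  -- The error constant is the number of vertices, positive since it is `suc n`.
  ≤+c/n⇒≤ᴿ {bound} {y} (positive⁻¹ ⟦ suc n ⟧ {{⟦⟧-pos n}}) (bound≤ln s (suc n) k)
  where
  x = fromℕ (γsd F)
  bound = (fromℕ 1 -ᴿ (fromℕ (suc s) /ᴿ suc (suc s)) *ᴿ (⟨ 1 / suc k ⟩^1/ suc s)) *ᴿ fromℕ (suc n)
  y = (fromℕ (suc n) *ᴿ (ln (suc k) +ᴿ fromℕ 1)) /ᴿ suc (suc s)
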